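{- Let $c,k$ be positive integers with $k$ odd, let $d,l,z$ be nonnegative integers, let $\zeta_{2c}$ be a primitive $2c$-th root of unity, and let $P\in\mathbb{Z}[\zeta_{2c}][x]$. If $n$ is an integer with $n\ge(\deg(P)+2(l+d)+1)kc$, then $$\sum_{m=0}^n \zeta_{2c}^m P(m)\,(q^z)^m\,\frac{d^l}{dq^l}\left[\binom{n}{m}_q\right]\equiv 0 \pmod{\Phi_{kc}(q)^{d+1}},$$ i.e. $\Phi_{kc}(q)^{d+1}$ divides the left-hand side in $\mathbb{Z}[\zeta_{2c}][q]$.
   Context: For integers $0\le m\le n$, the $q$-binomial coefficient is the polynomial $\binom{n}{m}_q=\frac{(1-q^n)(1-q^{n-1})\cdots(1-q^{n-m+1})}{(1-q^m)(1-q^{m-1})\cdots(1-q)}\in\mathbb{Z}[q]$. $\Phi_N(q)$ denotes the $N$-th cyclotomic polynomial. $\frac{d^l}{dq^l}$ is the $l$-th formal derivative with respect to $q$. -}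

module Defs where

open import Level using (0ℓ)
open import Algebra.Bundles.Raw using (RawRing)
open import Data.Nat as ℕ using (ℕ; zero; suc)
open import Data.Nat.Divisibility using (_∣?_)
open import Data.Integer as ℤ using (ℤ; +_)
open import Data.List using (List; []; _∷_; map; reverse; filter; upTo; length; drop; dropWhile)
open import Relation.Binary.PropositionalEquality using (_≡_)

open import Data.Product using (∃)

-- Univariate polynomials over a raw ring, as little-endian coefficient
-- lists (trailing zeros allowed).  Equality is coefficientwise.

module Poly (R : RawRing 0ℓ 0ℓ) where
  open RawRing R

  Poly : Set
  Poly = List Carrier

  coeff : Poly → ℕ → Carrier
  coeff []      _       = 0#
  coeff (a ∷ p) zero    = a
  coeff (a ∷ p) (suc i) = coeff p i

  _≈P_ : Poly → Poly → Set
  p ≈P q = ∀ i → coeff p i ≈ coeff q i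

  _+P_ : Poly → Poly → Poly
  []      +P q       = q
  (a ∷ p) +P []      = a ∷ p
  (a ∷ p) +P (b ∷ q) = (a + b) ∷ (p +P q)

  -P_ : Poly → Poly
  -P p = map -_ p

  scale : Carrier → Poly → Poly
  scale a p = map (a *_) p

  _*P_ : Poly → Poly → Poly
  []      *P q = []
  (a ∷ p) *P q = scale a q +P (0# ∷ (p *P q))

  0P : Poly
  0P = []

  1P : Poly
  1P = 1# ∷ []

  const : Carrier → Poly
  const a = a ∷ []

  X : Poly
  X = 0# ∷ 1# ∷ []

  _^P_ : Poly → ℕ → Poly
  p ^P zero  = 1P
  p ^P suc n = p *P (p ^P n)

  nat : ℕ → Carrier
  nat zero    = 0#
  nat (suc n) = 1# + nat n

  eval : Poly → Carrier → Carrier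
  eval []      x = 0#
  eval (a ∷ p) x = a + x * eval p x

  private
    derivAux : ℕ → Poly → Poly
    derivAux k []      = []
    derivAux k (a ∷ p) = (nat k * a) ∷ derivAux (suc k) p

  deriv : Poly → Poly
  deriv []      = []
  deriv (_ ∷ p) = derivAux 1 p

  derivN : ℕ → Poly → Poly
  derivN zero    p = p
  derivN (suc l) p = deriv (derivN l p)

  sumTo : ℕ → (ℕ → Poly) → Poly
  sumTo zero    f = f 0
  sumTo (suc n) f = sumTo n f +P f (suc n)

  qbinom : ℕ → ℕ → Poly
  qbinom n       zero    = 1P
  qbinom zero    (suc m) = 0P
  qbinom (suc n) (suc m) = qbinom n m +P ((X ^P suc m) *P qbinom n (suc m))

  rawRing : RawRing 0ℓ 0ℓ
  rawRing = record
    { Carrier = Poly ; _≈_ = _≈P_ ; _+_ = _+P_ ; _*_ = _*P_ ; -_ = -P_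
    ; 0# = 0P ; 1# = 1P }

ℤ-rawRing : RawRing 0ℓ 0ℓ
ℤ-rawRing = record
  { Carrier = ℤ ; _≈_ = _≡_ ; _+_ = ℤ._+_ ; _*_ = ℤ._*_ ; -_ = ℤ.-_
  ; 0# = + 0 ; 1# = + 1 }

module ZX = Poly ℤ-rawRing

-- Cyclotomic polynomials Φ_N ∈ ℤ[x], defined by the standard recursion
--   Φ_N = (x^N - 1) / ∏_{d ∣ N, d < N} Φ_d     (N ≥ 1),
-- with exact division by a monic polynomial.

private
  open ZX

  strip : ZX.Poly → ZX.Poly
  strip p = reverse (dropWhile (λ a → a ℤ.≟ + 0) (reverse p))

  dot : ZX.Poly → ZX.Poly → ℤ
  dot []      _       = + 0
  dot (_ ∷ _) []      = + 0
  dot (a ∷ p) (b ∷ q) = a ℤ.* b ℤ.+ dot p q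

  -- power-series division a / b (b has constant term 1), first len terms
  seriesDiv : ZX.Poly → ZX.Poly → ℕ → ZX.Poly
  seriesDiv a b len = go len 0 []
    where
    go : ℕ → ℕ → ZX.Poly → ZX.Poly
    go zero    i hs = reverse hs
    go (suc r) i hs = go r (suc i) ((coeff a i ℤ.- dot (drop 1 b) hs) ∷ hs)

  -- quotient of f by a monic g (exact when g ∣ f)
  exactDiv : ZX.Poly → ZX.Poly → ZX.Poly
  exactDiv f g =
    let f' = strip f ; g' = strip g in
    reverse (seriesDiv (reverse f') (reverse g') (suc (length f' ℕ.∸ length g')))

  prodP : List ZX.Poly → ZX.Poly
  prodP []       = 1P
  prodP (p ∷ ps) = p *P prodP ps

  properDivisors : ℕ → List ℕ
  properDivisors N = filter (_∣? N) (map suc (upTo (N ℕ.∸ 1)))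

  xN-1 : ℕ → ZX.Poly
  xN-1 N = (X ^P N) +P const (ℤ.- + 1)

  cycAux : ℕ → ℕ → ZX.Poly
  cycAux zero    N = 1P
  cycAux (suc f) N = exactDiv (xN-1 N) (prodP (map (cycAux f) (properDivisors N)))

-- Φ N is the N-th cyclotomic polynomial for N ≥ 1 (Φ 0 is junk, unused).
Φ : ℕ → ZX.Poly
Φ N = cycAux N N

-- ℤ[ζ_{2c}] is modelled as ℤ[t] modulo Φ_{2c}(t); polynomials over it in q
-- are modelled as ℤ[t][q] modulo the ideal generated by Φ_{2c}(t).

module ZTQ = Poly ZX.rawRing

liftZ : ZX.Poly → ZTQ.Poly
liftZ p = map ZX.const p

-- The left-hand side
--   Σ_{m=0}^n ζ^m P(m) (q^z)^m d^l/dq^l [n choose m]_q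
-- with ζ represented by t and P ∈ ℤ[t][x] a list of coefficients (in ℤ[t]).
lhs : (P : List ZX.Poly) (z l n : ℕ) → ZTQ.Poly
lhs P z l n = ZTQ.sumTo n λ m →
  ZTQ.const ((ZX.X ZX.^P m) ZX.*P ZTQ.eval P (ZTQ.nat m))
    ZTQ.*P ((ZTQ.X ZTQ.^P (z ℕ.* m))
    ZTQ.*P liftZ (ZX.derivN l (ZX.qbinom n m)))

-- Divisibility of F by G in ℤ[ζ_{2c}][q] = ℤ[t][q] / (Φ_{2c}(t)).
DividesInZζ[q] : (c : ℕ) → ZTQ.Poly → ZTQ.Poly → Set
DividesInZζ[q] c G F =
  ∃ λ (Q : ZTQ.Poly) → ∃ λ (R : ZTQ.Poly) →
    F ZTQ.≈P ((G ZTQ.*P Q) ZTQ.+P (ZTQ.const (Φ (2 ℕ.* c)) ZTQ.*P R))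

{-# OPTIONS --safe #-}

-- Let h_n(x) = Σ_m [n choose m]_q x^m, N = kc and Φ = Φ_N(q).  The recurrence
-- h_{n+1} = (1 + x) h_n − (1 − q^n) x h_{n−1} and Φ ∣ 1 − q^N give
-- h_{aN+r} ≡ h_r h_{aN} modulo Φ · (h_m : m ≥ aN − 1), and h_N ≡ 1 + x^N modulo Φ;
-- hence h_n lies in Σ_j Φ^j (1 + x^N)^{a−2j} whenever n ≥ aN.  The left-hand side arises
-- from h_n by l derivatives in q, each of which costs one Φ, by deg P applications of
-- differences in m, each of which costs one factor 1 + x^N, and by x = ζ q^z, which makes
-- 1 + x^N = 1 − q^{zN} divisible by Φ because ζ^{kc} = −1.
-- That Φ divides [N choose m]_q for 0 < m < N follows from
-- (1 − q^m) [N choose m]_q = (1 − q^N) [N−1 choose m−1]_q, as 1 − q^m is cancellable modulo Φ_N.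
module Submission where

open import Defs
open import Level using (0ℓ)
open import Algebra.Bundles using (CommutativeRing)
import Algebra.Solver.Ring
open import Algebra.Solver.Ring.AlmostCommutativeRing using (fromCommutativeRing; _-Raw-AlmostCommutative⟶_)
open import Data.Empty using (⊥-elim)
open import Data.Integer as ℤ using (ℤ; +_; -[1+_])
import Data.Integer.Properties as ℤₚ
open import Data.List using (List; []; _∷_; _++_; map; reverse; filter; upTo; applyUpTo; length; drop; dropWhile; foldl)
import Data.List.Properties as Listₚ
open import Data.List.Membership.Propositional using (_∈_)
open import Data.List.Membership.Propositional.Properties using (∈-filter⁺; ∈-filter⁻; ∈-map⁺; ∈-map⁻; ∈-upTo⁺; ∈-upTo⁻)
import Data.List.Relation.Unary.AllPairs.Properties as AllPairsₚ
open import Data.List.Relation.Unary.Any using (here; there)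
open import Data.Maybe as Maybe using (Maybe)
open import Data.Nat as ℕ using (ℕ; zero; suc; z≤n; s≤s)
open import Data.Nat.Divisibility using (_∣_; divides; _∣?_; ∣⇒≤; ∣-trans; n∣m*n)
open import Data.Nat.DivMod using (m≡m%n+[m/n]*n; _/_)
open import Data.Nat.GCD using (gcd; gcd[m,n]∣m; gcd[m,n]∣n; gcd-GCD; module Bézout)
open import Data.Nat.Induction using (<-rec)
import Data.Nat.Properties as ℕₚ
open import Data.Nat.Tactic.RingSolver using (solve-∀)
open import Data.Product using (∃; _,_; _×_; proj₁; proj₂)
open import Data.Sum using (_⊎_; inj₁; inj₂)
open import Relation.Binary.Bundles using (Setoid)
open import Relation.Binary.Definitions using (tri<; tri≈; tri>)
open import Relation.Binary.PropositionalEquality as ≡ using (_≡_; _≢_)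
open import Relation.Nullary using (¬_; yes; no; contradiction)
open import Relation.Nullary.Decidable using (dec⇒maybe)

-- The weights come from the recurrence. A shift by aN leaves an error Φ · h_{aN-1}, and h_{aN-1}
-- has level a - 1 only; for the error to reach level a + 1, one factor Φ must count as two factors
-- 1 + x^N. Hence each derivative and each power of Φ in the conclusion costs 2, and each difference
-- costs 1. The sums Σ_j Φ^j (1 + x^N)^{a-2j} are never written out: the predicate `G b` records
-- what such an element guarantees under all functionals and derivatives, and only its closure
-- properties enter. Every element has budget 2, because a positive power of Φ together with a
-- nonzero P already costs 3. These 2 units pay for one of the d + 1 powers, so deg P + 1 + 2(l + d)
-- blocks of length N suffice. On the cyclotomic side the obstacle is that `Φ` is the output of a
-- division algorithm over ℤ, whose exactness has to be proved. Being a non-zero-divisor modulo Φ_e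
-- takes the place of coprimality; this property, the factorisation of x^e - 1 and the monicity of
-- Φ_e are obtained together by strong induction on e.

-- The ring solver needs coefficients with decidable equality to see cancellations; ℤ maps to every ring.
module IntegerSolver (R : CommutativeRing 0ℓ 0ℓ) where
  open CommutativeRing R hiding (zero)
  open import Algebra.Properties.Ring ring
  open import Algebra.Properties.AbelianGroup +-abelianGroup using (⁻¹-∙-comm)
  open import Algebra.Properties.Semiring.Mult.TCOptimised semiring renaming (_×_ to _·_)
  open import Relation.Binary.Reasoning.Setoid setoid

  fromℤ : ℤ → Carrier
  fromℤ (+ n)      = n · 1#
  fromℤ (-[1+ n ]) = - (suc n · 1#)

  fromℤ-neg : ∀ i → fromℤ (ℤ.- i) ≈ - fromℤ i
  fromℤ-neg (+ zero)   = sym -0#≈0#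
  fromℤ-neg (+ suc n)  = refl
  fromℤ-neg (-[1+ n ]) = sym (-‿involutive _)

  private
    shift : ∀ x y z → (z + x) + - (z + y) ≈ x + - y
    shift x y z = begin
      (z + x) + - (z + y)   ≈⟨ +-congˡ (⁻¹-∙-comm z y) ⟨
      (z + x) + (- z + - y) ≈⟨ +-congʳ (+-comm z x) ⟩
      (x + z) + (- z + - y) ≈⟨ +-assoc x z _ ⟩
      x + (z + (- z + - y)) ≈⟨ +-congˡ (+-assoc z (- z) (- y)) ⟨
      x + ((z + - z) + - y) ≈⟨ +-congˡ (+-congʳ (-‿inverseʳ z)) ⟩
      x + (0# + - y)        ≈⟨ +-congˡ (+-identityˡ _) ⟩
      x + - y               ∎

  fromℤ-⊖ : ∀ m n → fromℤ (m ℤ.⊖ n) ≈ m · 1# + - (n · 1#)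
  fromℤ-⊖ m       zero    = sym (trans (+-congˡ -0#≈0#) (+-identityʳ _))
  fromℤ-⊖ zero    (suc n) = sym (+-identityˡ _)
  fromℤ-⊖ (suc m) (suc n) = begin
    fromℤ (suc m ℤ.⊖ suc n)           ≡⟨ ≡.cong fromℤ (ℤₚ.[1+m]⊖[1+n]≡m⊖n m n) ⟩
    fromℤ (m ℤ.⊖ n)                   ≈⟨ fromℤ-⊖ m n ⟩
    m · 1# + - (n · 1#)               ≈⟨ shift _ _ 1# ⟨
    (1# + m · 1#) + - (1# + n · 1#)   ≈⟨ +-cong (1+× m 1#) (-‿cong (1+× n 1#)) ⟨
    suc m · 1# + - (suc n · 1#)       ∎

  fromℤ-+ : ∀ i j → fromℤ (i ℤ.+ j) ≈ fromℤ i + fromℤ j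
  fromℤ-+ (+ m)      (+ n)      = ×-homo-+ 1# m n
  fromℤ-+ (+ m)      (-[1+ n ]) = fromℤ-⊖ m (suc n)
  fromℤ-+ (-[1+ m ]) (+ n)      = trans (fromℤ-⊖ n (suc m)) (+-comm _ _)
  fromℤ-+ (-[1+ m ]) (-[1+ n ]) = begin
    - (suc (suc (m ℕ.+ n)) · 1#)         ≡⟨ ≡.cong (λ k → - (suc k · 1#)) (ℕₚ.+-suc m n) ⟨
    - ((suc m ℕ.+ suc n) · 1#)           ≈⟨ -‿cong (×-homo-+ 1# (suc m) (suc n)) ⟩
    - (suc m · 1# + suc n · 1#)          ≈⟨ ⁻¹-∙-comm _ _ ⟨
    - (suc m · 1#) + - (suc n · 1#)      ∎

  fromℤ-*⁺ : ∀ m j → fromℤ (+ m ℤ.* j) ≈ fromℤ (+ m) * fromℤ j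
  fromℤ-*⁺ m (+ n) = begin
    fromℤ (+ m ℤ.* + n)  ≡⟨ ≡.cong fromℤ (ℤₚ.pos-* m n) ⟨
    (m ℕ.* n) · 1#       ≈⟨ ×1-homo-* m n ⟩
    (m · 1#) * (n · 1#)  ∎
  fromℤ-*⁺ m (-[1+ n ]) = begin
    fromℤ (+ m ℤ.* ℤ.- (+ suc n))  ≡⟨ ≡.cong fromℤ (ℤₚ.neg-distribʳ-* (+ m) (+ suc n)) ⟨
    fromℤ (ℤ.- (+ m ℤ.* + suc n))  ≈⟨ fromℤ-neg (+ m ℤ.* + suc n) ⟩
    - fromℤ (+ m ℤ.* + suc n)      ≈⟨ -‿cong (fromℤ-*⁺ m (+ suc n)) ⟩
    - ((m · 1#) * (suc n · 1#))    ≈⟨ -‿distribʳ-* _ _ ⟩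
    (m · 1#) * - (suc n · 1#)      ∎

  fromℤ-* : ∀ i j → fromℤ (i ℤ.* j) ≈ fromℤ i * fromℤ j
  fromℤ-* (+ m)      j = fromℤ-*⁺ m j
  fromℤ-* (-[1+ m ]) j = begin
    fromℤ (ℤ.- (+ suc m) ℤ.* j)    ≡⟨ ≡.cong fromℤ (ℤₚ.neg-distribˡ-* (+ suc m) j) ⟨
    fromℤ (ℤ.- (+ suc m ℤ.* j))    ≈⟨ fromℤ-neg (+ suc m ℤ.* j) ⟩
    - fromℤ (+ suc m ℤ.* j)        ≈⟨ -‿cong (fromℤ-*⁺ (suc m) j) ⟩
    - ((suc m · 1#) * fromℤ j)     ≈⟨ -‿distribˡ-* _ _ ⟩
    - (suc m · 1#) * fromℤ j       ∎

  private
    morphism : ℤ.+-*-rawRing -Raw-AlmostCommutative⟶ fromCommutativeRing R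
    morphism = record
      { ⟦_⟧ = fromℤ ; +-homo = fromℤ-+ ; *-homo = fromℤ-* ; -‿homo = fromℤ-neg
      ; 0-homo = refl ; 1-homo = refl }

    decide : ∀ i j → Maybe (fromℤ i ≈ fromℤ j)
    decide i j = Maybe.map (λ eq → reflexive (≡.cong fromℤ eq)) (dec⇒maybe (i ℤ.≟ j))

  open Algebra.Solver.Ring ℤ.+-*-rawRing (fromCommutativeRing R) morphism decide public
    using (solve; _:+_; _:*_; _:-_; :-_; _:=_; con)

-- The commutative ring of coefficient-list polynomials.

module PolyRing (R : CommutativeRing 0ℓ 0ℓ) where
  open CommutativeRing R hiding (zero)
  open import Algebra.Properties.Ring ring using (-0#≈0#)
  open IntegerSolver R
  open Poly (CommutativeRing.rawRing R) public
  private
    module ≈-Reasoning where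
      open import Relation.Binary.Reasoning.Setoid setoid public

  infix 4 _≋_

  -- The coefficientwise equality wrapped in a record, so that unification can recover both sides.
  record _≋_ (p q : Poly) : Set where
    constructor mk
    field at : p ≈P q
  open _≋_ public

  ≋-refl : ∀ {p} → p ≋ p
  ≋-refl = mk λ i → refl

  ≋-sym : ∀ {p q} → p ≋ q → q ≋ p
  ≋-sym e = mk λ i → sym (at e i)

  ≋-trans : ∀ {p q r} → p ≋ q → q ≋ r → p ≋ r
  ≋-trans e f = mk λ i → trans (at e i) (at f i)

  coeff-+ : ∀ p q i → coeff (p +P q) i ≈ coeff p i + coeff q i
  coeff-+ []      q       i       = sym (+-identityˡ _)
  coeff-+ (a ∷ p) []      i       = sym (+-identityʳ _)
  coeff-+ (a ∷ p) (b ∷ q) zero    = refl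
  coeff-+ (a ∷ p) (b ∷ q) (suc i) = coeff-+ p q i

  coeff-neg : ∀ p i → coeff (-P p) i ≈ - coeff p i
  coeff-neg []      i       = sym -0#≈0#
  coeff-neg (a ∷ p) zero    = refl
  coeff-neg (a ∷ p) (suc i) = coeff-neg p i

  coeff-scale : ∀ a p i → coeff (scale a p) i ≈ a * coeff p i
  coeff-scale a []      i       = sym (zeroʳ a)
  coeff-scale a (b ∷ p) zero    = refl
  coeff-scale a (b ∷ p) (suc i) = coeff-scale a p i

  ∷-cong : ∀ {a b p q} → a ≈ b → p ≋ q → a ∷ p ≋ b ∷ q
  ∷-cong e f = mk λ { zero → e ; (suc i) → at f i }

  ∷-tail : ∀ {a b p q} → a ∷ p ≋ b ∷ q → p ≋ q
  ∷-tail e = mk λ i → at e (suc i)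

  0∷0 : 0# ∷ [] ≋ []
  0∷0 = mk λ { zero → refl ; (suc i) → refl }

  +P-cong : ∀ {p q r s} → p ≋ q → r ≋ s → p +P r ≋ q +P s
  +P-cong {p} {q} {r} {s} e f = mk λ i →
    trans (coeff-+ p r i) (trans (+-cong (at e i) (at f i)) (sym (coeff-+ q s i)))

  +P-congˡ : ∀ p {q r} → q ≋ r → p +P q ≋ p +P r
  +P-congˡ p e = +P-cong (≋-refl {p}) e

  +P-congʳ : ∀ r {p q} → p ≋ q → p +P r ≋ q +P r
  +P-congʳ r e = +P-cong e (≋-refl {r})

  +P-assoc : ∀ p q r → (p +P q) +P r ≋ p +P (q +P r)
  +P-assoc p q r = mk λ i → begin
    coeff ((p +P q) +P r) i                ≈⟨ coeff-+ (p +P q) r i ⟩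
    coeff (p +P q) i + coeff r i           ≈⟨ +-congʳ (coeff-+ p q i) ⟩
    (coeff p i + coeff q i) + coeff r i    ≈⟨ +-assoc _ _ _ ⟩
    coeff p i + (coeff q i + coeff r i)    ≈⟨ +-congˡ (coeff-+ q r i) ⟨
    coeff p i + coeff (q +P r) i           ≈⟨ coeff-+ p (q +P r) i ⟨
    coeff (p +P (q +P r)) i                ∎
    where open ≈-Reasoning

  +P-comm : ∀ p q → p +P q ≋ q +P p
  +P-comm p q = mk λ i → trans (coeff-+ p q i) (trans (+-comm _ _) (sym (coeff-+ q p i)))

  +P-identityʳ : ∀ p → p +P [] ≋ p
  +P-identityʳ p = mk λ i → trans (coeff-+ p [] i) (+-identityʳ _)

  -P-cong : ∀ {p q} → p ≋ q → -P p ≋ -P q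
  -P-cong {p} {q} e = mk λ i → trans (coeff-neg p i) (trans (-‿cong (at e i)) (sym (coeff-neg q i)))

  -P-inverseʳ : ∀ p → p +P (-P p) ≋ []
  -P-inverseʳ p = mk λ i → trans (coeff-+ p (-P p) i) (trans (+-congˡ (coeff-neg p i)) (-‿inverseʳ _))

  scale-cong : ∀ {a b p q} → a ≈ b → p ≋ q → scale a p ≋ scale b q
  scale-cong {a} {b} {p} {q} e f = mk λ i →
    trans (coeff-scale a p i) (trans (*-cong e (at f i)) (sym (coeff-scale b q i)))

  scale-+ : ∀ a p q → scale a (p +P q) ≋ scale a p +P scale a q
  scale-+ a p q = mk λ i → begin
    coeff (scale a (p +P q)) i                 ≈⟨ coeff-scale a (p +P q) i ⟩
    a * coeff (p +P q) i                       ≈⟨ *-congˡ (coeff-+ p q i) ⟩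
    a * (coeff p i + coeff q i)                ≈⟨ distribˡ _ _ _ ⟩
    a * coeff p i + a * coeff q i              ≈⟨ +-cong (coeff-scale a p i) (coeff-scale a q i) ⟨
    coeff (scale a p) i + coeff (scale a q) i  ≈⟨ coeff-+ (scale a p) (scale a q) i ⟨
    coeff (scale a p +P scale a q) i           ∎
    where open ≈-Reasoning

  scale-scale : ∀ a b p → scale a (scale b p) ≋ scale (a * b) p
  scale-scale a b p = mk λ i → begin
    coeff (scale a (scale b p)) i  ≈⟨ coeff-scale a (scale b p) i ⟩
    a * coeff (scale b p) i        ≈⟨ *-congˡ (coeff-scale b p i) ⟩
    a * (b * coeff p i)            ≈⟨ *-assoc _ _ _ ⟨
    a * b * coeff p i              ≈⟨ coeff-scale (a * b) p i ⟨
    coeff (scale (a * b) p) i      ∎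
    where open ≈-Reasoning

  scale-0 : ∀ p → scale 0# p ≋ []
  scale-0 p = mk λ i → trans (coeff-scale 0# p i) (zeroˡ _)

  scale-1 : ∀ p → scale 1# p ≋ p
  scale-1 p = mk λ i → trans (coeff-scale 1# p i) (*-identityˡ _)

  scale-0∷ : ∀ a p → scale a (0# ∷ p) ≋ 0# ∷ scale a p
  scale-0∷ a p = ∷-cong (zeroʳ a) ≋-refl

  0∷-+ : ∀ p q → 0# ∷ (p +P q) ≋ (0# ∷ p) +P (0# ∷ q)
  0∷-+ p q = ∷-cong (sym (+-identityˡ 0#)) ≋-refl

  +P-interchange : ∀ p q r s → (p +P q) +P (r +P s) ≋ (p +P r) +P (q +P s)
  +P-interchange p q r s = mk λ i → begin
    coeff ((p +P q) +P (r +P s)) i                           ≈⟨ expand p q r s i ⟩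
    (coeff p i + coeff q i) + (coeff r i + coeff s i)        ≈⟨ solve 4 (λ p q r s → (p :+ q) :+ (r :+ s) := (p :+ r) :+ (q :+ s)) refl _ _ _ _ ⟩
    (coeff p i + coeff r i) + (coeff q i + coeff s i)        ≈⟨ expand p r q s i ⟨
    coeff ((p +P r) +P (q +P s)) i                           ∎
    where
    open ≈-Reasoning
    expand : ∀ p q r s i → coeff ((p +P q) +P (r +P s)) i ≈ (coeff p i + coeff q i) + (coeff r i + coeff s i)
    expand p q r s i = trans (coeff-+ (p +P q) (r +P s) i) (+-cong (coeff-+ p q i) (coeff-+ r s i))

  ≋-setoid : Setoid 0ℓ 0ℓ
  ≋-setoid = record
    { Carrier = Poly ; _≈_ = _≋_ ; isEquivalence = record { refl = ≋-refl ; sym = ≋-sym ; trans = ≋-trans } }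

  module ≋-Reasoning where
    open import Relation.Binary.Reasoning.Setoid ≋-setoid public
  open ≋-Reasoning

  *P-congˡ : ∀ p {q r} → q ≋ r → p *P q ≋ p *P r
  *P-congˡ []      e = ≋-refl
  *P-congˡ (a ∷ p) e = +P-cong (scale-cong refl e) (∷-cong refl (*P-congˡ p e))

  *P-distribˡ : ∀ p q r → p *P (q +P r) ≋ (p *P q) +P (p *P r)
  *P-distribˡ []      q r = ≋-refl
  *P-distribˡ (a ∷ p) q r = begin
    scale a (q +P r) +P (0# ∷ (p *P (q +P r)))
      ≈⟨ +P-cong (scale-+ a q r) (≋-trans (∷-cong refl (*P-distribˡ p q r)) (0∷-+ (p *P q) (p *P r))) ⟩
    (scale a q +P scale a r) +P ((0# ∷ (p *P q)) +P (0# ∷ (p *P r)))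
      ≈⟨ +P-interchange (scale a q) (scale a r) (0# ∷ (p *P q)) (0# ∷ (p *P r)) ⟩
    (scale a q +P (0# ∷ (p *P q))) +P (scale a r +P (0# ∷ (p *P r))) ∎

  *P-zeroʳ : ∀ p → p *P [] ≋ []
  *P-zeroʳ []      = ≋-refl
  *P-zeroʳ (a ∷ p) = ≋-trans (∷-cong refl (*P-zeroʳ p)) 0∷0

  *P-∷ : ∀ p b q → p *P (b ∷ q) ≋ scale b p +P (0# ∷ (p *P q))
  *P-∷ []      b q = ≋-sym 0∷0
  *P-∷ (a ∷ p) b q = ∷-cong (+-congʳ (*-comm a b)) (begin
    scale a q +P (p *P (b ∷ q))                     ≈⟨ +P-cong ≋-refl (*P-∷ p b q) ⟩
    scale a q +P (scale b p +P (0# ∷ (p *P q)))     ≈⟨ +P-assoc (scale a q) (scale b p) (0# ∷ (p *P q)) ⟨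
    (scale a q +P scale b p) +P (0# ∷ (p *P q))     ≈⟨ +P-cong (+P-comm (scale a q) (scale b p)) ≋-refl ⟩
    (scale b p +P scale a q) +P (0# ∷ (p *P q))     ≈⟨ +P-assoc (scale b p) (scale a q) (0# ∷ (p *P q)) ⟩
    scale b p +P (scale a q +P (0# ∷ (p *P q)))     ∎)

  *P-comm : ∀ p q → p *P q ≋ q *P p
  *P-comm []      q = ≋-sym (*P-zeroʳ q)
  *P-comm (a ∷ p) q = ≋-trans (+P-cong ≋-refl (∷-cong refl (*P-comm p q))) (≋-sym (*P-∷ q a p))

  *P-cong : ∀ {p q r s} → p ≋ q → r ≋ s → p *P r ≋ q *P s
  *P-cong {p} {q} {r} {s} e f = begin
    p *P r  ≈⟨ *P-congˡ p f ⟩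
    p *P s  ≈⟨ *P-comm p s ⟩
    s *P p  ≈⟨ *P-congˡ s e ⟩
    s *P q  ≈⟨ *P-comm s q ⟩
    q *P s  ∎

  *P-congʳ : ∀ r {p q} → p ≋ q → p *P r ≋ q *P r
  *P-congʳ r e = *P-cong e (≋-refl {r})

  *P-distribʳ : ∀ r p q → (p +P q) *P r ≋ (p *P r) +P (q *P r)
  *P-distribʳ r p q = begin
    (p +P q) *P r          ≈⟨ *P-comm (p +P q) r ⟩
    r *P (p +P q)          ≈⟨ *P-distribˡ r p q ⟩
    (r *P p) +P (r *P q)   ≈⟨ +P-cong (*P-comm r p) (*P-comm r q) ⟩
    (p *P r) +P (q *P r)   ∎

  scale-*P : ∀ a p q → scale a p *P q ≋ scale a (p *P q)
  scale-*P a []      q = ≋-refl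
  scale-*P a (b ∷ p) q = begin
    scale (a * b) q +P (0# ∷ (scale a p *P q))
      ≈⟨ +P-cong (≋-sym (scale-scale a b q)) (≋-trans (∷-cong refl (scale-*P a p q)) (≋-sym (scale-0∷ a (p *P q)))) ⟩
    scale a (scale b q) +P scale a (0# ∷ (p *P q))
      ≈⟨ scale-+ a (scale b q) (0# ∷ (p *P q)) ⟨
    scale a (scale b q +P (0# ∷ (p *P q))) ∎

  0∷-*P : ∀ p q → (0# ∷ p) *P q ≋ 0# ∷ (p *P q)
  0∷-*P p q = +P-cong (scale-0 q) ≋-refl

  *P-assoc : ∀ p q r → (p *P q) *P r ≋ p *P (q *P r)
  *P-assoc []      q r = ≋-refl
  *P-assoc (a ∷ p) q r = begin
    (scale a q +P (0# ∷ (p *P q))) *P r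
      ≈⟨ *P-distribʳ r (scale a q) (0# ∷ (p *P q)) ⟩
    (scale a q *P r) +P ((0# ∷ (p *P q)) *P r)
      ≈⟨ +P-cong (scale-*P a q r) (≋-trans (0∷-*P (p *P q) r) (∷-cong refl (*P-assoc p q r))) ⟩
    scale a (q *P r) +P (0# ∷ (p *P (q *P r))) ∎

  const-* : ∀ a p → const a *P p ≋ scale a p
  const-* a p = ≋-trans (+P-cong ≋-refl 0∷0) (+P-identityʳ (scale a p))

  X-* : ∀ p → X *P p ≋ 0# ∷ p
  X-* p = ≋-trans (0∷-*P 1P p) (∷-cong refl (≋-trans (const-* 1# p) (scale-1 p)))

  ring≋ : CommutativeRing 0ℓ 0ℓ
  ring≋ = record
    { Carrier = Poly ; _≈_ = _≋_ ; _+_ = _+P_ ; _*_ = _*P_ ; -_ = -P_ ; 0# = 0P ; 1# = 1P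
    ; isCommutativeRing = record
      { isRing = record
        { +-isAbelianGroup = record
          { isGroup = record
            { isMonoid = record
              { isSemigroup = record
                { isMagma = record
                  { isEquivalence = record { refl = ≋-refl ; sym = ≋-sym ; trans = ≋-trans }
                  ; ∙-cong = +P-cong }
                ; assoc = +P-assoc }
              ; identity = (λ p → ≋-refl) , +P-identityʳ }
            ; inverse = (λ p → ≋-trans (+P-comm (-P p) p) (-P-inverseʳ p)) , -P-inverseʳ
            ; ⁻¹-cong = -P-cong }
          ; comm = +P-comm }
        ; *-cong = *P-cong
        ; *-assoc = *P-assoc
        ; *-identity = *P-identityˡ , λ p → ≋-trans (*P-comm p 1P) (*P-identityˡ p)
        ; distrib = *P-distribˡ , *P-distribʳ }
      ; *-comm = *P-comm } }
    where
    *P-identityˡ : ∀ p → 1P *P p ≋ p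
    *P-identityˡ p = ≋-trans (const-* 1# p) (scale-1 p)

  private module S = CommutativeRing ring≋

  -- The same ring with the bare equality _≈P_, whose raw ring is the parameter of the iterated module Poly.
  polyRing : CommutativeRing 0ℓ 0ℓ
  polyRing = record
    { Carrier = Poly ; _≈_ = _≈P_ ; _+_ = _+P_ ; _*_ = _*P_ ; -_ = -P_ ; 0# = 0P ; 1# = 1P
    ; isCommutativeRing = record
      { isRing = record
        { +-isAbelianGroup = record
          { isGroup = record
            { isMonoid = record
              { isSemigroup = record
                { isMagma = record
                  { isEquivalence = record
                    { refl = λ i → refl ; sym = λ e i → sym (e i) ; trans = λ e f i → trans (e i) (f i) }
                  ; ∙-cong = λ {p} {q} {r} {s} e f → at (+P-cong {p} {q} {r} {s} (mk e) (mk f)) }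
                ; assoc = λ p q r → at (+P-assoc p q r) }
              ; identity = (λ p i → refl) , λ p → at (+P-identityʳ p) }
            ; inverse = (λ p → at (S.-‿inverseˡ p)) , λ p → at (-P-inverseʳ p)
            ; ⁻¹-cong = λ {p} {q} e → at (-P-cong {p} {q} (mk e)) }
          ; comm = λ p q → at (+P-comm p q) }
        ; *-cong = λ {p} {q} {r} {s} e f → at (*P-cong {p} {q} {r} {s} (mk e) (mk f))
        ; *-assoc = λ p q r → at (*P-assoc p q r)
        ; *-identity = (λ p → at (S.*-identityˡ p)) , λ p → at (S.*-identityʳ p)
        ; distrib = (λ p q r → at (*P-distribˡ p q r)) , λ p q r → at (*P-distribʳ p q r) }
      ; *-comm = λ p q → at (*P-comm p q) } }

module Ideals (R : CommutativeRing 0ℓ 0ℓ) where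
  open CommutativeRing R hiding (zero)

  record IsIdeal (J : Carrier → Set) : Set where
    field
      J-cong : ∀ {a b} → a ≈ b → J a → J b
      J-0    : J 0#
      J-+    : ∀ {a b} → J a → J b → J (a + b)
      J-*    : ∀ r {a} → J a → J (r * a)

-- Powers, derivatives, monic polynomials and divisibility.

module PolyLemmas (R : CommutativeRing 0ℓ 0ℓ) where
  open CommutativeRing R hiding (zero)
  open PolyRing R
  open Ideals R
  module 𝓡 = IntegerSolver R
  module 𝓟 = IntegerSolver ring≋
  private
    module ≈-Reasoning where
      open import Relation.Binary.Reasoning.Setoid setoid public

  ≡⇒≋ : ∀ {p q} → p ≡ q → p ≋ q
  ≡⇒≋ ≡.refl = ≋-refl

  ^P-+ : ∀ p m n → p ^P (m ℕ.+ n) ≋ (p ^P m) *P (p ^P n)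
  ^P-+ p zero    n = ≋-sym (CommutativeRing.*-identityˡ ring≋ _)
  ^P-+ p (suc m) n = ≋-trans (*P-congˡ p (^P-+ p m n)) (≋-sym (*P-assoc p (p ^P m) (p ^P n)))

  ^P-*-comm : ∀ p q n → (p *P q) ^P n ≋ (p ^P n) *P (q ^P n)
  ^P-*-comm p q zero    = ≋-sym (CommutativeRing.*-identityˡ ring≋ _)
  ^P-*-comm p q (suc n) = ≋-trans (*P-congˡ (p *P q) (^P-*-comm p q n))
    (𝓟.solve 4 (λ p q a b → (p 𝓟.:* q) 𝓟.:* (a 𝓟.:* b) 𝓟.:= (p 𝓟.:* a) 𝓟.:* (q 𝓟.:* b)) ≋-refl p q (p ^P n) (q ^P n))

  1^P : ∀ n → 1P ^P n ≋ 1P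
  1^P zero    = ≋-refl
  1^P (suc n) = ≋-trans (CommutativeRing.*-identityˡ ring≋ _) (1^P n)

  ^P-* : ∀ p m n → p ^P (m ℕ.* n) ≋ (p ^P m) ^P n
  ^P-* p zero    n = ≋-sym (1^P n)
  ^P-* p (suc m) n = ≋-trans (^P-+ p n (m ℕ.* n)) (≋-trans (*P-congˡ (p ^P n) (^P-* p m n)) (≋-sym (^P-*-comm p (p ^P m) n)))

  nat-+ : ∀ m n → nat (m ℕ.+ n) ≈ nat m + nat n
  nat-+ zero    n = sym (+-identityˡ _)
  nat-+ (suc m) n = trans (+-congˡ (nat-+ m n)) (sym (+-assoc _ _ _))

  const-cong : ∀ {a b} → a ≈ b → const a ≋ const b
  const-cong e = ∷-cong e ≋-refl

  const-*P : ∀ a b → const (a * b) ≋ const a *P const b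
  const-*P a b = ≋-sym (const-* a (const b))

  sumTo-cong : ∀ n {f g} → (∀ i → f i ≋ g i) → sumTo n f ≋ sumTo n g
  sumTo-cong zero    e = e 0
  sumTo-cong (suc n) e = +P-cong (sumTo-cong n e) (e (suc n))

  sumTo-suc : ∀ n f → sumTo (suc n) f ≋ f 0 +P sumTo n (λ i → f (suc i))
  sumTo-suc zero    f = ≋-refl
  sumTo-suc (suc n) f = ≋-trans (+P-cong (sumTo-suc n f) ≋-refl) (+P-assoc (f 0) (sumTo n (λ i → f (suc i))) (f (suc (suc n))))

  *P-sumTo : ∀ p n f → p *P sumTo n f ≋ sumTo n (λ i → p *P f i)
  *P-sumTo p zero    f = ≋-refl
  *P-sumTo p (suc n) f = ≋-trans (*P-distribˡ p (sumTo n f) (f (suc n))) (+P-cong (*P-sumTo p n f) ≋-refl)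

  coeff-applyUpTo : ∀ f n → (∀ i → n ℕ.≤ i → f i ≈ 0#) → ∀ i → coeff (applyUpTo f n) i ≈ f i
  coeff-applyUpTo f zero    z i       = sym (z i z≤n)
  coeff-applyUpTo f (suc n) z zero    = refl
  coeff-applyUpTo f (suc n) z (suc i) = coeff-applyUpTo (λ j → f (suc j)) n (λ j le → z (suc j) (s≤s le)) i

  coeff-X^-diag : ∀ n → coeff (X ^P n) n ≈ 1#
  coeff-X^-diag zero    = refl
  coeff-X^-diag (suc n) = trans (at (X-* (X ^P n)) (suc n)) (coeff-X^-diag n)

  coeff-X^-off : ∀ n m → m ≢ n → coeff (X ^P n) m ≈ 0#
  coeff-X^-off zero    zero    m≢n = contradiction ≡.refl m≢n
  coeff-X^-off zero    (suc m) m≢n = refl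
  coeff-X^-off (suc n) zero    m≢n = at (X-* (X ^P n)) zero
  coeff-X^-off (suc n) (suc m) m≢n = trans (at (X-* (X ^P n)) (suc m)) (coeff-X^-off n m (λ e → m≢n (≡.cong suc e)))

  -- The helper of deriv is not exported by Defs; unification recovers it once its first argument is generalised.
  mutual
    derivAux : ℕ → Poly → Poly
    derivAux = _

    deriv-derivAux : ∀ a p → deriv (a ∷ p) ≡ derivAux 1 p
    deriv-derivAux a p with 1
    ... | k = ≡.refl

  coeff-derivAux : ∀ k p i → coeff (derivAux k p) i ≈ nat (k ℕ.+ i) * coeff p i
  coeff-derivAux k []      i       = sym (zeroʳ _)
  coeff-derivAux k (a ∷ p) zero    = reflexive (≡.cong (λ j → nat j * a) (≡.sym (ℕₚ.+-identityʳ k)))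
  coeff-derivAux k (a ∷ p) (suc i) =
    trans (coeff-derivAux (suc k) p i) (reflexive (≡.cong (λ j → nat j * coeff p i) (≡.sym (ℕₚ.+-suc k i))))

  coeff-deriv : ∀ p i → coeff (deriv p) i ≈ nat (suc i) * coeff p (suc i)
  coeff-deriv []      i = sym (zeroʳ _)
  coeff-deriv (a ∷ p) i = coeff-derivAux 1 p i

  deriv-cong : ∀ {p q} → p ≋ q → deriv p ≋ deriv q
  deriv-cong {p} {q} e = mk λ i → trans (coeff-deriv p i) (trans (*-congˡ (at e (suc i))) (sym (coeff-deriv q i)))

  deriv-+ : ∀ p q → deriv (p +P q) ≋ deriv p +P deriv q
  deriv-+ p q = mk λ i → begin
    coeff (deriv (p +P q)) i                                     ≈⟨ coeff-deriv (p +P q) i ⟩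
    nat (suc i) * coeff (p +P q) (suc i)                         ≈⟨ *-congˡ (coeff-+ p q (suc i)) ⟩
    nat (suc i) * (coeff p (suc i) + coeff q (suc i))            ≈⟨ distribˡ _ _ _ ⟩
    nat (suc i) * coeff p (suc i) + nat (suc i) * coeff q (suc i) ≈⟨ +-cong (coeff-deriv p i) (coeff-deriv q i) ⟨
    coeff (deriv p) i + coeff (deriv q) i                        ≈⟨ coeff-+ (deriv p) (deriv q) i ⟨
    coeff (deriv p +P deriv q) i                                 ∎
    where open ≈-Reasoning

  deriv-scale : ∀ a p → deriv (scale a p) ≋ scale a (deriv p)
  deriv-scale a p = mk λ i → begin
    coeff (deriv (scale a p)) i                ≈⟨ coeff-deriv (scale a p) i ⟩
    nat (suc i) * coeff (scale a p) (suc i)    ≈⟨ *-congˡ (coeff-scale a p (suc i)) ⟩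
    nat (suc i) * (a * coeff p (suc i))        ≈⟨ 𝓡.solve 3 (λ n a c → n 𝓡.:* (a 𝓡.:* c) 𝓡.:= a 𝓡.:* (n 𝓡.:* c)) refl _ _ _ ⟩
    a * (nat (suc i) * coeff p (suc i))        ≈⟨ *-congˡ (coeff-deriv p i) ⟨
    a * coeff (deriv p) i                      ≈⟨ coeff-scale a (deriv p) i ⟨
    coeff (scale a (deriv p)) i                ∎
    where open ≈-Reasoning

  deriv-∷ : ∀ a p → deriv (a ∷ p) ≋ p +P (0# ∷ deriv p)
  deriv-∷ a p = mk λ i → trans (coeff-deriv (a ∷ p) i) (trans (step i) (sym (coeff-+ p (0# ∷ deriv p) i)))
    where
    step : ∀ i → nat (suc i) * coeff p i ≈ coeff p i + coeff (0# ∷ deriv p) i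
    step zero    = trans (*-congʳ (+-identityʳ 1#)) (trans (*-identityˡ _) (sym (+-identityʳ _)))
    step (suc i) = trans (distribʳ _ _ _) (+-cong (*-identityˡ _) (sym (coeff-deriv p i)))

  deriv-* : ∀ p q → deriv (p *P q) ≋ (deriv p *P q) +P (p *P deriv q)
  deriv-* []      q = ≋-refl
  deriv-* (a ∷ p) q = begin
    deriv (scale a q +P (0# ∷ (p *P q)))
      ≈⟨ deriv-+ (scale a q) (0# ∷ (p *P q)) ⟩
    deriv (scale a q) +P deriv (0# ∷ (p *P q))
      ≈⟨ +P-cong (deriv-scale a q) (deriv-∷ 0# (p *P q)) ⟩
    scale a (deriv q) +P ((p *P q) +P (0# ∷ deriv (p *P q)))
      ≈⟨ +P-congˡ (scale a (deriv q)) (+P-congˡ (p *P q) (≋-trans (∷-cong refl (deriv-* p q)) (0∷-+ (deriv p *P q) (p *P deriv q)))) ⟩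
    scale a (deriv q) +P ((p *P q) +P ((0# ∷ (deriv p *P q)) +P (0# ∷ (p *P deriv q))))
      ≈⟨ 𝓟.solve 4 (λ a b c d → a 𝓟.:+ (b 𝓟.:+ (c 𝓟.:+ d)) 𝓟.:= (b 𝓟.:+ c) 𝓟.:+ (a 𝓟.:+ d)) ≋-refl
           (scale a (deriv q)) (p *P q) (0# ∷ (deriv p *P q)) (0# ∷ (p *P deriv q)) ⟩
    ((p *P q) +P (0# ∷ (deriv p *P q))) +P ((a ∷ p) *P deriv q)
      ≈⟨ +P-congʳ ((a ∷ p) *P deriv q) (+P-congˡ (p *P q) (0∷-*P (deriv p) q)) ⟨
    ((p *P q) +P ((0# ∷ deriv p) *P q)) +P ((a ∷ p) *P deriv q)
      ≈⟨ +P-congʳ ((a ∷ p) *P deriv q) (*P-distribʳ q p (0# ∷ deriv p)) ⟨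
    ((p +P (0# ∷ deriv p)) *P q) +P ((a ∷ p) *P deriv q)
      ≈⟨ +P-congʳ ((a ∷ p) *P deriv q) (*P-congʳ q (deriv-∷ a p)) ⟨
    (deriv (a ∷ p) *P q) +P ((a ∷ p) *P deriv q) ∎
    where open ≋-Reasoning

  record Monic (n : ℕ) (p : Poly) : Set where
    field
      lead  : coeff p n ≈ 1#
      above : ∀ i → n ℕ.< i → coeff p i ≈ 0#
  open Monic public

  Monic-cong : ∀ {n p q} → p ≋ q → Monic n p → Monic n q
  Monic-cong e m = record
    { lead = trans (sym (at e _)) (lead m) ; above = λ i n<i → trans (sym (at e i)) (above m i n<i) }

  coeff-*-above : ∀ m n p q → (∀ i → m ℕ.< i → coeff p i ≈ 0#) → (∀ i → n ℕ.< i → coeff q i ≈ 0#) →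
    ∀ k → m ℕ.+ n ℕ.< k → coeff (p *P q) k ≈ 0#
  coeff-*-above m n []      q hp hq k lt = refl
  coeff-*-above m n (a ∷ p) q hp hq (suc k) lt = begin
    coeff (scale a q +P (0# ∷ (p *P q))) (suc k)      ≈⟨ coeff-+ (scale a q) (0# ∷ (p *P q)) (suc k) ⟩
    coeff (scale a q) (suc k) + coeff (p *P q) k      ≈⟨ +-cong (coeff-scale a q (suc k)) (rest m hp lt) ⟩
    a * coeff q (suc k) + 0#                          ≈⟨ +-identityʳ _ ⟩
    a * coeff q (suc k)                               ≈⟨ *-congˡ (hq (suc k) (ℕₚ.≤-<-trans (ℕₚ.m≤n+m n m) lt)) ⟩
    a * 0#                                            ≈⟨ zeroʳ a ⟩
    0#                                                ∎
    where
    open ≈-Reasoning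
    rest : ∀ m → (∀ i → m ℕ.< i → coeff (a ∷ p) i ≈ 0#) → m ℕ.+ n ℕ.< suc k → coeff (p *P q) k ≈ 0#
    rest zero    hp lt = at (*P-congʳ q {p} {[]} (mk λ i → hp (suc i) (s≤s z≤n))) k
    rest (suc m) hp (s≤s lt) = coeff-*-above m n p q (λ i m<i → hp (suc i) (s≤s m<i)) hq k lt

  coeff-*-top : ∀ m n p q → (∀ i → m ℕ.< i → coeff p i ≈ 0#) → (∀ i → n ℕ.< i → coeff q i ≈ 0#) →
    coeff (p *P q) (m ℕ.+ n) ≈ coeff p m * coeff q n
  coeff-*-top m       n []      q hp hq = sym (zeroˡ _)
  coeff-*-top zero    n (a ∷ p) q hp hq = begin
    coeff ((a ∷ p) *P q) n   ≈⟨ at (*P-congʳ q {a ∷ p} {const a} (∷-cong refl (mk λ i → hp (suc i) (s≤s z≤n)))) n ⟩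
    coeff (const a *P q) n   ≈⟨ at (const-* a q) n ⟩
    coeff (scale a q) n      ≈⟨ coeff-scale a q n ⟩
    a * coeff q n            ∎
    where open ≈-Reasoning
  coeff-*-top (suc m) n (a ∷ p) q hp hq = begin
    coeff (scale a q +P (0# ∷ (p *P q))) (suc (m ℕ.+ n))     ≈⟨ coeff-+ (scale a q) (0# ∷ (p *P q)) (suc (m ℕ.+ n)) ⟩
    coeff (scale a q) (suc (m ℕ.+ n)) + coeff (p *P q) (m ℕ.+ n) ≈⟨ +-congʳ (coeff-scale a q (suc (m ℕ.+ n))) ⟩
    a * coeff q (suc (m ℕ.+ n)) + coeff (p *P q) (m ℕ.+ n)   ≈⟨ +-congʳ (*-congˡ (hq _ (s≤s (ℕₚ.m≤n+m n m)))) ⟩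
    a * 0# + coeff (p *P q) (m ℕ.+ n)                        ≈⟨ +-congʳ (zeroʳ a) ⟩
    0# + coeff (p *P q) (m ℕ.+ n)                            ≈⟨ +-identityˡ _ ⟩
    coeff (p *P q) (m ℕ.+ n)                                 ≈⟨ coeff-*-top m n p q (λ i m<i → hp (suc i) (s≤s m<i)) hq ⟩
    coeff p m * coeff q n                                    ∎
    where open ≈-Reasoning

  Monic-* : ∀ {m n p q} → Monic m p → Monic n q → Monic (m ℕ.+ n) (p *P q)
  Monic-* {m} {n} {p} {q} mp mq = record
    { lead  = trans (coeff-*-top m n p q (above mp) (above mq)) (trans (*-cong (lead mp) (lead mq)) (*-identityˡ 1#))
    ; above = coeff-*-above m n p q (above mp) (above mq) }

  module MonicQuotient {Z : Carrier → Set} (isIdeal : IsIdeal Z) where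
    open IsIdeal isIdeal renaming (J-cong to Z-cong; J-0 to Z-0; J-+ to Z-+; J-* to Z-*)

    coeff-Z : ∀ g h → (∀ i → Z (coeff h i)) → ∀ i → Z (coeff (g *P h) i)
    coeff-Z []      h hz i = Z-0
    coeff-Z (a ∷ g) h hz i = Z-cong (sym (coeff-+ (scale a h) (0# ∷ (g *P h)) i))
      (Z-+ (Z-cong (sym (coeff-scale a h i)) (Z-* a (hz i))) (tail i))
      where
      tail : ∀ i → Z (coeff (0# ∷ (g *P h)) i)
      tail zero    = Z-0
      tail (suc i) = coeff-Z g h hz i

    -- Long division from the top: the coefficients of the tail `h` come first, because `g` vanishes
    -- beyond degree `n`; then `b` is the coefficient of degree `n` minus a combination of those,
    -- the leading coefficient being 1. With the zero ideal this bounds degrees, with the multiples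
    -- of an integer it divides coefficients.
    monic-quotient : ∀ {n g} → Monic n g → ∀ h k → (∀ i → k ℕ.≤ i → Z (coeff (g *P h) (n ℕ.+ i))) →
      ∀ i → k ℕ.≤ i → Z (coeff h i)
    monic-quotient mg [] k hz i k≤i = Z-0
    monic-quotient {n} {g} mg (b ∷ h) k hz = result k hz
      where
      expand : ∀ i → coeff (g *P (b ∷ h)) i ≈ b * coeff g i + coeff (0# ∷ (g *P h)) i
      expand i = trans (at (*P-∷ g b h) i)
        (trans (coeff-+ (scale b g) (0# ∷ (g *P h)) i) (+-congʳ (coeff-scale b g i)))

      shifted : ∀ i → Z (coeff (g *P (b ∷ h)) (n ℕ.+ suc i)) → Z (coeff (g *P h) (n ℕ.+ i))
      shifted i z rewrite ℕₚ.+-suc n i = Z-cong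
        (trans (expand (suc (n ℕ.+ i)))
          (trans (+-congʳ (trans (*-congˡ (above mg _ (s≤s (ℕₚ.m≤m+n n i)))) (zeroʳ b))) (+-identityˡ _))) z

      tail : (∀ i → Z (coeff h i)) → ∀ i → Z (coeff (0# ∷ (g *P h)) i)
      tail hz zero    = Z-0
      tail hz (suc i) = coeff-Z g h hz i

      result : ∀ k → (∀ i → k ℕ.≤ i → Z (coeff (g *P (b ∷ h)) (n ℕ.+ i))) → ∀ i → k ℕ.≤ i → Z (coeff (b ∷ h) i)
      result (suc k) hz (suc i) (s≤s k≤i) =
        monic-quotient mg h k (λ j k≤j → shifted j (hz (suc j) (s≤s k≤j))) i k≤i
      result zero hz (suc i) _ = monic-quotient mg h 0 (λ j _ → shifted j (hz (suc j) z≤n)) i z≤n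
      result zero hz zero    _ = Z-cong eq (Z-+ (hz 0 z≤n) (Z-* (- 1#)
        (tail (λ i → monic-quotient mg h 0 (λ j _ → shifted j (hz (suc j) z≤n)) i z≤n) n)))
        where
        eq : coeff (g *P (b ∷ h)) (n ℕ.+ 0) + - 1# * coeff (0# ∷ (g *P h)) n ≈ b
        eq = begin
          coeff (g *P (b ∷ h)) (n ℕ.+ 0) + - 1# * coeff (0# ∷ (g *P h)) n
            ≡⟨ ≡.cong (λ j → coeff (g *P (b ∷ h)) j + - 1# * coeff (0# ∷ (g *P h)) n) (ℕₚ.+-identityʳ n) ⟩
          coeff (g *P (b ∷ h)) n + - 1# * coeff (0# ∷ (g *P h)) n
            ≈⟨ +-congʳ (trans (expand n) (+-congʳ (*-congˡ (lead mg)))) ⟩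
          (b * 1# + coeff (0# ∷ (g *P h)) n) + - 1# * coeff (0# ∷ (g *P h)) n
            ≈⟨ 𝓡.solve 2 (λ b c → (b 𝓡.:* 𝓡.con (ℤ.+ 1) 𝓡.:+ c) 𝓡.:+ 𝓡.:- 𝓡.con (ℤ.+ 1) 𝓡.:* c 𝓡.:= b) refl b _ ⟩
          b ∎
          where
          open ≈-Reasoning

  infix 4 _∣P_
  record _∣P_ (p f : Poly) : Set where
    constructor dividesP
    field
      quotient : Poly
      equality : f ≋ p *P quotient

  ∣P-refl : ∀ {p} → p ∣P p
  ∣P-refl {p} = dividesP 1P (≋-sym (CommutativeRing.*-identityʳ ring≋ p))

  ∣P-trans : ∀ {p q f} → p ∣P q → q ∣P f → p ∣P f
  ∣P-trans {p} (dividesP s e) (dividesP u h) = dividesP (s *P u) (≋-trans h (≋-trans (*P-congʳ u e) (*P-assoc p s u)))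

  ∣P-cong : ∀ {p f g} → f ≋ g → p ∣P f → p ∣P g
  ∣P-cong e (dividesP s h) = dividesP s (≋-trans (≋-sym e) h)

  ∣P-+ : ∀ {p f g} → p ∣P f → p ∣P g → p ∣P f +P g
  ∣P-+ {p} (dividesP s e) (dividesP u h) = dividesP (s +P u) (≋-trans (+P-cong e h) (≋-sym (*P-distribˡ p s u)))

  ∣P-*ˡ : ∀ {p f} g → p ∣P f → p ∣P g *P f
  ∣P-*ˡ {p} g (dividesP s e) = dividesP (g *P s) (≋-trans (*P-congˡ g e)
    (𝓟.solve 3 (λ g p s → g 𝓟.:* (p 𝓟.:* s) 𝓟.:= p 𝓟.:* (g 𝓟.:* s)) ≋-refl g p s))

  ∣P-*ʳ : ∀ {p f} g → p ∣P f → p ∣P f *P g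
  ∣P-*ʳ {p} {f} g d = ∣P-cong (*P-comm g f) (∣P-*ˡ g d)

-- q-binomial coefficients: absorption and three-term recurrence.

module QBinomial (R : CommutativeRing 0ℓ 0ℓ) where
  open CommutativeRing R hiding (zero)
  open PolyRing R
  open PolyLemmas R
  open 𝓟 using (solve; _:+_; _:*_; _:-_; :-_; _:=_; con)

  qbinom-> : ∀ n m → n ℕ.< m → qbinom n m ≋ []
  qbinom-> zero    (suc m) lt       = ≋-refl
  qbinom-> (suc n) (suc m) (s≤s lt) = ≋-trans (+P-cong (qbinom-> n m lt) (*P-congˡ (X ^P suc m) (qbinom-> n (suc m) (ℕₚ.m<n⇒m<1+n lt))))
    (*P-zeroʳ (X ^P suc m))

  qbinom-diag : ∀ n → qbinom n n ≋ 1P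
  qbinom-diag zero    = ≋-refl
  qbinom-diag (suc n) = ≋-trans (+P-cong (qbinom-diag n) (≋-trans (*P-congˡ (X ^P suc n) (qbinom-> n (suc n) ℕₚ.≤-refl)) (*P-zeroʳ (X ^P suc n)))) (+P-identityʳ 1P)

  1-X^ : ℕ → Poly
  1-X^ n = 1P +P (-P (X ^P n))

  qbinom-absorb : ∀ n m → 1-X^ (suc m) *P qbinom (suc n) (suc m) ≋ 1-X^ (suc n) *P qbinom n m
  qbinom-absorb zero zero =
    *P-congˡ (1-X^ 1) (≋-trans (+P-congˡ 1P (*P-zeroʳ (X ^P 1))) (+P-identityʳ 1P))
  qbinom-absorb zero (suc m) =
    ≋-trans (*P-congˡ (1-X^ (suc (suc m))) (*P-zeroʳ (X ^P suc (suc m))))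
      (≋-trans (*P-zeroʳ (1-X^ (suc (suc m)))) (≋-sym (*P-zeroʳ (1-X^ 1))))
  qbinom-absorb (suc n) zero = begin
    1-X^ 1 *P (1P +P ((X ^P 1) *P B))
      ≈⟨ solve 2 (λ y b → (con (+ 1) :- y) :* (con (+ 1) :+ y :* b) := (con (+ 1) :- y) :+ y :* ((con (+ 1) :- y) :* b)) ≋-refl (X ^P 1) B ⟩
    1-X^ 1 +P ((X ^P 1) *P (1-X^ 1 *P B))
      ≈⟨ +P-congˡ (1-X^ 1) (*P-congˡ (X ^P 1) (qbinom-absorb n 0)) ⟩
    1-X^ 1 +P ((X ^P 1) *P (1-X^ (suc n) *P 1P))
      ≈⟨ solve 2 (λ x a → (con (+ 1) :- x :* con (+ 1)) :+ (x :* con (+ 1)) :* ((con (+ 1) :- a) :* con (+ 1)) := (con (+ 1) :- x :* a) :* con (+ 1)) ≋-refl X (X ^P suc n) ⟩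
    1-X^ (suc (suc n)) *P 1P ∎
    where
    open ≋-Reasoning
    B = qbinom (suc n) 1
  qbinom-absorb (suc n) (suc m) = begin
    1-X^ (suc (suc m)) *P (U +P ((X *P p) *P V))
      ≈⟨ solve 4 (λ x p u v → (con (+ 1) :- x :* p) :* (u :+ (x :* p) :* v) := (con (+ 1) :- x :* p) :* u :+ (x :* p) :* ((con (+ 1) :- x :* p) :* v)) ≋-refl X p U V ⟩
    (1-X^ (suc (suc m)) *P U) +P ((X *P p) *P (1-X^ (suc (suc m)) *P V))
      ≈⟨ +P-congˡ (1-X^ (suc (suc m)) *P U) (*P-congˡ (X *P p) (qbinom-absorb n (suc m))) ⟩
    (1-X^ (suc (suc m)) *P U) +P ((X *P p) *P (1-X^ (suc n) *P T))
      -- `W +P (p *P T)` is `U` by definition, so `p T` is traded for `U − W`; the instance at `m`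
      -- then turns the `W` term into a multiple of `U`.
      ≈⟨ solve 6 (λ x p a u w t → (con (+ 1) :- x :* p) :* u :+ (x :* p) :* ((con (+ 1) :- a) :* t) :=
           (con (+ 1) :- x :* p) :* u :+ x :* ((con (+ 1) :- a) :* (w :+ p :* t) :- (con (+ 1) :- a) :* w)) ≋-refl X p a U W T ⟩
    (1-X^ (suc (suc m)) *P U) +P (X *P ((1-X^ (suc n) *P U) +P (-P (1-X^ (suc n) *P W))))
      ≈⟨ +P-congˡ (1-X^ (suc (suc m)) *P U) (*P-congˡ X (+P-congˡ (1-X^ (suc n) *P U) (-P-cong (qbinom-absorb n m)))) ⟨
    (1-X^ (suc (suc m)) *P U) +P (X *P ((1-X^ (suc n) *P U) +P (-P (1-X^ (suc m) *P U))))
      ≈⟨ solve 4 (λ x p a u → (con (+ 1) :- x :* p) :* u :+ x :* ((con (+ 1) :- a) :* u :- (con (+ 1) :- p) :* u) := (con (+ 1) :- x :* a) :* u) ≋-refl X p a U ⟩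
    1-X^ (suc (suc n)) *P U ∎
    where
    open ≋-Reasoning
    p = X ^P suc m
    a = X ^P suc n
    U = qbinom (suc n) (suc m)
    V = qbinom (suc n) (suc (suc m))
    W = qbinom n m
    T = qbinom n (suc m)

  -- The weight q^{m+1} of the q-Pascal rule depends on `m`. Written as 1 - (1 - q^{m+1}), it is
  -- converted by absorption into 1 - q^{n+1}, which does not; only then does the rule become a
  -- recurrence for the generating function in x.
  qbinom-recurrence : ∀ n m → qbinom (suc (suc n)) (suc m) ≋
    (qbinom (suc n) (suc m) +P qbinom (suc n) m) +P (-P (1-X^ (suc n) *P qbinom n m))
  qbinom-recurrence n m = begin
    B +P ((X ^P suc m) *P A)
      ≈⟨ solve 3 (λ b p a → b :+ p :* a := (a :+ b) :- (con (+ 1) :- p) :* a) ≋-refl B (X ^P suc m) A ⟩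
    (A +P B) +P (-P (1-X^ (suc m) *P A))
      ≈⟨ +P-congˡ (A +P B) (-P-cong (qbinom-absorb n m)) ⟩
    (A +P B) +P (-P (1-X^ (suc n) *P qbinom n m)) ∎
    where
    open ≋-Reasoning
    A = qbinom (suc n) (suc m)
    B = qbinom (suc n) m

-- Degree measured by finite differences.

module FiniteDifference (R : CommutativeRing 0ℓ 0ℓ) where
  open CommutativeRing R hiding (zero)
  open Poly (CommutativeRing.rawRing R)
  open IntegerSolver R
  open PolyLemmas R using (nat-+)

  -- All step sizes are allowed, since the differences taken later have step N. At 0 only the zero
  -- function is left, so the index is a strict bound on the degree.
  Deg< : ℕ → (ℕ → Carrier) → Set
  Deg< zero    f = ∀ m → f m ≈ 0#
  Deg< (suc p) f = ∀ s → Deg< p (λ m → f (s ℕ.+ m) + - f m)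

  Deg<-cong : ∀ p {f g} → (∀ m → f m ≈ g m) → Deg< p f → Deg< p g
  Deg<-cong zero    e d m = trans (sym (e m)) (d m)
  Deg<-cong (suc p) e d s = Deg<-cong p (λ m → +-cong (e (s ℕ.+ m)) (-‿cong (e m))) (d s)

  Deg<-shift : ∀ p {f} j → Deg< p f → Deg< p (λ m → f (j ℕ.+ m))
  Deg<-shift zero    j d m = d (j ℕ.+ m)
  Deg<-shift (suc p) {f} j d s = Deg<-cong p (λ m → +-congʳ (reflexive (≡.cong f (swap s j m)))) (Deg<-shift p j (d s))
    where
    swap : ∀ s j m → s ℕ.+ (j ℕ.+ m) ≡ j ℕ.+ (s ℕ.+ m)
    swap s j m = ≡.trans (≡.sym (ℕₚ.+-assoc s j m)) (≡.trans (≡.cong (ℕ._+ m) (ℕₚ.+-comm s j)) (ℕₚ.+-assoc j s m))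

  Deg<-+ : ∀ p {f g} → Deg< p f → Deg< p g → Deg< p (λ m → f m + g m)
  Deg<-+ zero    d e m = trans (+-cong (d m) (e m)) (+-identityˡ 0#)
  Deg<-+ (suc p) d e s = Deg<-cong p
    (λ m → solve 4 (λ a b c d → (a :- b) :+ (c :- d) := (a :+ c) :- (b :+ d)) refl _ _ _ _) (Deg<-+ p (d s) (e s))

  Deg<-* : ∀ p {f} c → Deg< p f → Deg< p (λ m → c * f m)
  Deg<-* zero    c d m = trans (*-congˡ (d m)) (zeroʳ c)
  Deg<-* (suc p) c d s = Deg<-cong p (λ m → solve 3 (λ c a b → c :* (a :- b) := c :* a :- c :* b) refl c _ _) (Deg<-* p c (d s))

  -- Discrete Leibniz rule: (s + m) f(s + m) - m f(m) = m (f(s + m) - f(m)) + s f(s + m).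
  Deg<-nat* : ∀ p {f} → Deg< p f → Deg< (suc p) (λ m → nat m * f m)
  Deg<-nat* zero    d s m = trans (+-cong (*-congˡ (d (s ℕ.+ m))) (-‿cong (*-congˡ (d m))))
    (solve 2 (λ a b → a :* con (+ 0) :- b :* con (+ 0) := con (+ 0)) refl _ _)
  Deg<-nat* (suc p) {f} d s = Deg<-cong (suc p)
    (λ m → trans (solve 4 (λ m s a b → m :* (a :- b) :+ s :* a := (s :+ m) :* a :- m :* b) refl (nat m) (nat s) (f (s ℕ.+ m)) (f m))
                 (+-congʳ (*-congʳ (sym (nat-+ s m)))))
    (Deg<-+ (suc p) (Deg<-nat* p (d s)) (Deg<-* (suc p) (nat s) (Deg<-shift (suc p) s d)))

  Deg<-const+ : ∀ p {f} c → Deg< (suc p) f → Deg< (suc p) (λ m → c + f m)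
  Deg<-const+ p c d s = Deg<-cong p (λ m → solve 3 (λ c a b → a :- b := (c :+ a) :- (c :+ b)) refl c _ _) (d s)

  -- Horner evaluation multiplies by the argument once per list entry.
  Deg<-eval : ∀ P → Deg< (length P) (λ m → eval P (nat m))
  Deg<-eval []      m = refl
  Deg<-eval (a ∷ P) = Deg<-const+ (length P) a (Deg<-nat* (length P) (Deg<-eval P))

-- A filtration along a three-term recurrence.

-- In the application h_n = Σ_m [n choose m]_q x^m is a Rogers–Szegő polynomial, u_n = 1 − q^n and φ = Φ_N(q).
module ThreeTermRecurrence (K : CommutativeRing 0ℓ 0ℓ) where
  open CommutativeRing K hiding (zero)
  open IntegerSolver K

  open Ideals K

  module Sequence (h u : ℕ → Carrier) (x φ : Carrier)
      (h-0 : h 0 ≈ 1#) (h-1 : h 1 ≈ 1# + x) (u-0 : u 0 ≈ 0#)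
      (h-rec : ∀ n → h (suc (suc n)) ≈ (1# + x) * h (suc n) + - (x * (u (suc n) * h n))) where

    -- Modulo φJ, the sequence r ↦ h_{r+M} satisfies the same recurrence as r ↦ h_r h_M.
    module _ {J : Carrier → Set} (isIdeal : IsIdeal J) where
      open IsIdeal isIdeal

      h-shift : ∀ M → (∀ r → ∃ λ s → u (r ℕ.+ M) ≈ u r + φ * s) → (∀ m → M ℕ.≤ suc m → J (h m)) →
        ∀ r → ∃ λ y → J y × h (r ℕ.+ M) ≈ h r * h M + φ * y
      h-shift zero per hJ r = 0# , J-0 ,
        trans (reflexive (≡.cong h (ℕₚ.+-identityʳ r))) (trans (solve 2 (λ a f → a := a :* con (+ 1) :+ f :* con (+ 0)) refl (h r) φ)
          (+-congʳ (*-congˡ (sym h-0))))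
      h-shift M@(suc M') per hJ r = proj₁ (both r)
        where
        Claim : ℕ → Set
        Claim r = ∃ λ y → J y × h (r ℕ.+ M) ≈ h r * h M + φ * y

        first : Claim 0
        first = 0# , J-0 , trans (solve 2 (λ a f → a := con (+ 1) :* a :+ f :* con (+ 0)) refl (h M) φ) (+-congʳ (*-congʳ (sym h-0)))

        -- At r = 1 the recurrence reaches back to h_{M-1}. Its coefficient u_M is a multiple of `φ`
        -- because u_0 = 0; this is why `J` has to contain h_{M-1} as well.
        second : Claim 1
        second with per 0
        ... | s , e = - (x * s) * h M' , J-* _ (hJ M' ℕₚ.≤-refl) ,
          trans (h-rec M') (trans (+-congˡ (-‿cong (*-congˡ (*-congʳ (trans e (+-congʳ u-0))))))
            (trans (solve 5 (λ x a f s b → (con (+ 1) :+ x) :* a :- x :* ((con (+ 0) :+ f :* s) :* b) := (con (+ 1) :+ x) :* a :+ f :* (:- (x :* s) :* b)) refl x (h M) φ s (h M'))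
              (+-congʳ (*-congʳ (sym h-1)))))

        -- The errors of the two preceding claims obey the recurrence themselves; the third summand
        -- of the witness is the new error from replacing u_{r+1+M} by u_{r+1}.
        next : ∀ r → Claim r → Claim (suc r) → Claim (suc (suc r))
        next r (y₀ , Jy₀ , e₀) (y₁ , Jy₁ , e₁) with per (suc r)
        ... | s , e = ((1# + x) * y₁ + - (x * u (suc r)) * y₀) + - (x * s) * h (r ℕ.+ M) ,
          J-+ (J-+ (J-* _ Jy₁) (J-* _ Jy₀)) (J-* _ (hJ (r ℕ.+ M) (ℕₚ.m≤n⇒m≤1+n (ℕₚ.m≤n+m M r)))) ,
          (begin
            h (suc (suc (r ℕ.+ M)))
              ≈⟨ h-rec (r ℕ.+ M) ⟩
            (1# + x) * h (suc (r ℕ.+ M)) + - (x * (u (suc (r ℕ.+ M)) * h (r ℕ.+ M)))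
              ≈⟨ +-cong (*-congˡ e₁) (-‿cong (*-congˡ (*-congʳ e))) ⟩
            (1# + x) * (h (suc r) * h M + φ * y₁) + - (x * ((u (suc r) + φ * s) * h (r ℕ.+ M)))
              ≈⟨ solve 7 (λ x a f y u s b → (con (+ 1) :+ x) :* (a :+ f :* y) :- x :* ((u :+ f :* s) :* b) :=
                   ((con (+ 1) :+ x) :* (a :+ f :* y) :- (x :* u) :* b) :+ f :* (:- (x :* s) :* b)) refl
                   x (h (suc r) * h M) φ y₁ (u (suc r)) s (h (r ℕ.+ M)) ⟩
            ((1# + x) * (h (suc r) * h M + φ * y₁) + - ((x * u (suc r)) * h (r ℕ.+ M))) + φ * (- (x * s) * h (r ℕ.+ M))
              ≈⟨ +-congʳ (+-congˡ (-‿cong (*-congˡ e₀))) ⟩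
            ((1# + x) * (h (suc r) * h M + φ * y₁) + - ((x * u (suc r)) * (h r * h M + φ * y₀))) + φ * (- (x * s) * h (r ℕ.+ M))
              ≈⟨ solve 9 (λ x a f y₁ u b y₀ c z → ((con (+ 1) :+ x) :* (a :* c :+ f :* y₁) :- (x :* u) :* (b :* c :+ f :* y₀)) :+ f :* z :=
                   ((con (+ 1) :+ x) :* a :- x :* (u :* b)) :* c :+ f :* (((con (+ 1) :+ x) :* y₁ :+ :- (x :* u) :* y₀) :+ z)) refl
                   x (h (suc r)) φ y₁ (u (suc r)) (h r) y₀ (h M) (- (x * s) * h (r ℕ.+ M)) ⟩
            ((1# + x) * h (suc r) + - (x * (u (suc r) * h r))) * h M + φ * (((1# + x) * y₁ + - (x * u (suc r)) * y₀) + - (x * s) * h (r ℕ.+ M))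
              ≈⟨ +-congʳ (*-congʳ (h-rec r)) ⟨
            h (suc (suc r)) * h M + φ * (((1# + x) * y₁ + - (x * u (suc r)) * y₀) + - (x * s) * h (r ℕ.+ M)) ∎)
          where open import Relation.Binary.Reasoning.Setoid setoid

        both : ∀ r → Claim r × Claim (suc r)
        both zero    = first , second
        both (suc r) = let (a , b) = both r in b , next r a b

    module Filtration (N : ℕ) (0<N : 0 ℕ.< N) (ψ γ : Carrier) (h-N : h N ≈ ψ + φ * γ)
        (per : ∀ a r → ∃ λ s → u (r ℕ.+ a ℕ.* N) ≈ u r + φ * s)
        (G : ℕ → Carrier → Set) (isIdeal : ∀ b → IsIdeal (G b))
        (G-mono : ∀ {b c y} → b ℕ.≤ c → G c y → G b y)
        (G-2 : ∀ y → G 2 y)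
        (G-φ : ∀ {b y} → G b y → G (2 ℕ.+ b) (φ * y))
        (G-ψ : ∀ {b y} → G b y → G (suc b) (ψ * y)) where

      -- Two claims are carried along the induction: `Below` reaches one index further down than
      -- `Main`, to m = aN - 1, at the cost of one level, because a shift by aN produces an error
      -- involving h_{aN-1}.
      h-filtration : ∀ a m → a ℕ.* N ℕ.≤ m → G (2 ℕ.+ a) (h m)
      h-filtration a = proj₁ (claims a)
        where
        Main : ℕ → Set
        Main a = ∀ m → a ℕ.* N ℕ.≤ m → G (2 ℕ.+ a) (h m)
        Below : ℕ → Set
        Below a = ∀ m → a ℕ.* N ℕ.≤ suc m → G (suc a) (h m)

        below : ∀ a → Main a → Below (suc a)
        below a main m le = main m (ℕₚ.≤-pred (ℕₚ.≤-trans (ℕₚ.+-monoˡ-≤ (a ℕ.* N) 0<N) le))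

        combine : ∀ b {y z w} → y ≈ z + φ * w → G b z → G b (φ * w) → G b y
        combine b e gz gw = IsIdeal.J-cong (isIdeal b) (sym e) (IsIdeal.J-+ (isIdeal b) gz gw)

        -- Shift by aN, evaluated at r = N. The product h_N h_{aN} gains one level through `ψ`, and
        -- the error is `φ` times an element of level 1 + a, hence of level exactly 3 + a.
        corner : ∀ a → Main a → Below a → G (3 ℕ.+ a) (h (suc a ℕ.* N))
        corner a main bel with h-shift (isIdeal (suc a)) (a ℕ.* N) (per a) bel N
        ... | y , Gy , e = combine (3 ℕ.+ a) e
          (combine (3 ℕ.+ a) (trans (*-congʳ h-N) (solve 4 (λ p f g k → (p :+ f :* g) :* k := p :* k :+ f :* (g :* k)) refl ψ φ γ (h (a ℕ.* N))))
            (G-ψ (main (a ℕ.* N) ℕₚ.≤-refl))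
            (G-mono (ℕₚ.n≤1+n _) (G-φ (IsIdeal.J-* (isIdeal (2 ℕ.+ a)) γ (main (a ℕ.* N) ℕₚ.≤-refl)))))
          (G-φ Gy)

        -- A second shift, by (a + 1)N, carries the level of the corner to every later `m`: up to a
        -- multiple of `φ`, h_m is a multiple of the corner.
        step : ∀ a → Main a → Below a → Main (suc a)
        step a main bel m le with h-shift (isIdeal (2 ℕ.+ a)) (suc a ℕ.* N) (per (suc a)) (below a main) (m ℕ.∸ suc a ℕ.* N)
        ... | y , Gy , e = combine (3 ℕ.+ a) (trans (reflexive (≡.cong h (≡.sym (ℕₚ.m∸n+n≡m le)))) e)
          (IsIdeal.J-* (isIdeal (3 ℕ.+ a)) _ (corner a main bel))
          (G-mono (ℕₚ.n≤1+n _) (G-φ Gy))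

        claims : ∀ a → Main a × Below a
        claims zero    = (λ m _ → G-2 (h m)) , (λ m _ → G-mono (s≤s z≤n) (G-2 (h m)))
        claims (suc a) = let (main , bel) = claims a in step a main bel , below a main

-- Access to the functions that compute `Φ`.

open ≡ using (refl)

-- The helpers of Φ are not exported by Defs.  Each is recovered by unification
-- from a definitional unfolding of Φ in which its arguments (and the functions
-- applied to its result) have been generalised to variables.

strip : ZX.Poly → ZX.Poly
strip p = reverse (dropWhile (ℤ._≟ + 0) (reverse p))

properDivisors : ℕ → List ℕ
properDivisors N = filter (_∣? N) (map suc (upTo (N ℕ.∸ 1)))

xN-1 : ℕ → ZX.Poly
xN-1 N = (ZX.X ZX.^P N) ZX.+P ZX.const (ℤ.- + 1)

mutual
  quot : ℕ → ZX.Poly → List ℕ → ZX.Poly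
  quot = _

  Φ-suc : ∀ n → Φ (suc n) ≡ quot n (xN-1 (suc n)) (properDivisors (suc n))
  Φ-suc n with xN-1 (suc n) | properDivisors (suc n)
  ... | f | ds = refl

mutual
  -- This is the local loop of the power-series division, with the parameters of its enclosing
  -- function as first arguments. The empty list of divisors makes the divisor the concrete
  -- polynomial 1, so one round of the loop evaluates and exposes the next call, with counter 1.
  divLoop : ZX.Poly → ZX.Poly → ℕ → ℕ → ℕ → ZX.Poly → ZX.Poly
  divLoop = _

  quot-[] : ∀ n f → let a = reverse (strip f) ; r = length (strip f) ℕ.∸ 1 in
    quot n f [] ≡ reverse (divLoop a (+ 1 ∷ []) (suc r) r 1 ((ZX.coeff a 0 ℤ.+ + 0) ∷ []))
  quot-[] n f with strip f
  ... | f' with reverse f' | length f' ℕ.∸ 1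
  ... | a | r with ZX.coeff a 0 ℤ.+ + 0
  ... | x with x ∷ [] | suc r | + 1 ∷ []
  ... | hs | len | b with 1 | foldl {A = ZX.Poly} {B = ℤ} (λ y x → x ∷ y) []
  ... | i | rev = refl

mutual
  dot : ZX.Poly → ZX.Poly → ℤ
  dot = _

  divLoop-1 : ∀ a e b len i hs → divLoop a (e ∷ b) len 1 i hs ≡ reverse ((ZX.coeff a i ℤ.- dot b hs) ∷ hs)
  divLoop-1 a e b len i hs = refl

mutual
  prodCyc : ℕ → List ℕ → ZX.Poly
  prodCyc = _

  quot-eq : ∀ n f ds → let f' = strip f ; g = strip (prodCyc n ds) ; r = length f' ℕ.∸ length g in
     quot n f ds ≡ reverse (divLoop (reverse f') (reverse g) (suc r) (suc r) 0 [])
  quot-eq n f ds with foldl {A = ZX.Poly} {B = ℤ} (λ y x → x ∷ y) []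
  ... | rev = refl

mutual
  cycAux : ℕ → ℕ → ZX.Poly
  cycAux = _

  prodCyc-∷ : ∀ n d → prodCyc n (d ∷ []) ≡ cycAux n d ZX.*P ZX.1P
  prodCyc-∷ n d with ZX._*P_
  ... | mul = refl

ℤ-ring : CommutativeRing 0ℓ 0ℓ
ℤ-ring = ℤₚ.+-*-commutativeRing

module 𝕊 where
  open PolyRing ℤ-ring public
  open PolyLemmas ℤ-ring public

-- Correctness of the division algorithm on coefficient lists.

module Cyclotomy where
  open 𝕊
  open Ideals ℤ-ring
  open 𝓟 using (solve; _:+_; _:*_; _:-_; :-_; _:=_; con)

  exactDiv : Poly → Poly → Poly
  exactDiv f g = let f' = strip f ; g' = strip g ; r = length f' ℕ.∸ length g' in
    reverse (divLoop (reverse f') (reverse g') (suc r) (suc r) 0 [])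

  coeff-++ˡ : ∀ p q i → i ℕ.< length p → coeff (p ++ q) i ≡ coeff p i
  coeff-++ˡ (a ∷ p) q zero    lt       = refl
  coeff-++ˡ (a ∷ p) q (suc i) (s≤s lt) = coeff-++ˡ p q i lt

  coeff-++ʳ : ∀ p q i → coeff (p ++ q) (length p ℕ.+ i) ≡ coeff q i
  coeff-++ʳ []      q i = refl
  coeff-++ʳ (a ∷ p) q i = coeff-++ʳ p q i

  coeff-length : ∀ p i → length p ℕ.≤ i → coeff p i ≡ + 0
  coeff-length []      i       le       = refl
  coeff-length (a ∷ p) (suc i) (s≤s le) = coeff-length p i le

  coeff-last : ∀ p a → coeff (reverse p ++ a ∷ []) (length p) ≡ a
  coeff-last p a = ≡.subst (λ n → coeff (reverse p ++ a ∷ []) n ≡ a)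
    (≡.trans (ℕₚ.+-identityʳ _) (Listₚ.length-reverse p)) (coeff-++ʳ (reverse p) (a ∷ []) 0)

  coeff-reverse : ∀ p i j → suc (i ℕ.+ j) ≡ length p → coeff (reverse p) i ≡ coeff p j
  coeff-reverse (a ∷ p) i zero    eq rewrite Listₚ.unfold-reverse a p | ℕₚ.+-identityʳ i | ℕₚ.suc-injective eq = coeff-last p a
  coeff-reverse (a ∷ p) i (suc j) eq rewrite Listₚ.unfold-reverse a p =
    ≡.trans (coeff-++ˡ (reverse p) (a ∷ []) i
              (≡.subst (i ℕ.<_) (≡.trans eq' (≡.sym (Listₚ.length-reverse p))) (s≤s (ℕₚ.m≤m+n i j))))
            (coeff-reverse p i j eq')
    where
    eq' : suc (i ℕ.+ j) ≡ length p
    eq' = ≡.trans (≡.sym (ℕₚ.+-suc i j)) (ℕₚ.suc-injective eq)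

  coeff-drop : ∀ k h i → coeff (drop k h) i ≡ coeff h (k ℕ.+ i)
  coeff-drop zero    h       i = refl
  coeff-drop (suc k) []      i = refl
  coeff-drop (suc k) (a ∷ h) i = coeff-drop k h i

  dot-∷ʳ : ∀ r a h → dot (r ++ a ∷ []) h ≡ dot r h ℤ.+ a ℤ.* coeff h (length r)
  dot-∷ʳ []      a []      = ≡.sym (≡.trans (ℤₚ.+-identityˡ _) (ℤₚ.*-zeroʳ a))
  dot-∷ʳ []      a (b ∷ h) = ℤₚ.+-comm (a ℤ.* b) (+ 0)
  dot-∷ʳ (c ∷ r) a []      = ≡.sym (≡.trans (ℤₚ.+-identityˡ _) (ℤₚ.*-zeroʳ a))
  dot-∷ʳ (c ∷ r) a (b ∷ h) = ≡.trans (≡.cong (λ x → c ℤ.* b ℤ.+ x) (dot-∷ʳ r a h)) (≡.sym (ℤₚ.+-assoc (c ℤ.* b) _ _))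

  -- The inner product is the convolution sum for that coefficient: the last entry of `g` meets
  -- entry `k` of `h`. It links the loop, which runs on reversed lists, to multiplication.
  dot-reverse : ∀ g h k → dot (reverse g) (drop k h) ≡ coeff (g *P h) (length g ℕ.∸ 1 ℕ.+ k)
  dot-reverse []      h k = refl
  dot-reverse (a ∷ g) h k = begin
    dot (reverse (a ∷ g)) (drop k h)                                       ≡⟨ ≡.cong (λ r → dot r (drop k h)) (Listₚ.unfold-reverse a g) ⟩
    dot (reverse g ++ a ∷ []) (drop k h)                                   ≡⟨ dot-∷ʳ (reverse g) a (drop k h) ⟩
    dot (reverse g) (drop k h) ℤ.+ a ℤ.* coeff (drop k h) (length (reverse g)) ≡⟨ ≡.cong₂ ℤ._+_ (tail g) head ⟩
    coeff (+ 0 ∷ (g *P h)) (length g ℕ.+ k) ℤ.+ coeff (scale a h) (length g ℕ.+ k) ≡⟨ ℤₚ.+-comm (coeff (+ 0 ∷ (g *P h)) (length g ℕ.+ k)) _ ⟩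
    coeff (scale a h) (length g ℕ.+ k) ℤ.+ coeff (+ 0 ∷ (g *P h)) (length g ℕ.+ k) ≡⟨ coeff-+ (scale a h) (+ 0 ∷ (g *P h)) (length g ℕ.+ k) ⟨
    coeff ((a ∷ g) *P h) (length g ℕ.+ k)                                  ∎
    where
    open ≡.≡-Reasoning
    tail : ∀ g → dot (reverse g) (drop k h) ≡ coeff (+ 0 ∷ (g *P h)) (length g ℕ.+ k)
    tail []      = zero-coeff k
      where
      zero-coeff : ∀ k → + 0 ≡ coeff (+ 0 ∷ []) k
      zero-coeff zero    = refl
      zero-coeff (suc k) = refl
    tail (b ∷ g) = dot-reverse (b ∷ g) h k
    head : a ℤ.* coeff (drop k h) (length (reverse g)) ≡ coeff (scale a h) (length g ℕ.+ k)
    head = begin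
      a ℤ.* coeff (drop k h) (length (reverse g))  ≡⟨ ≡.cong (λ n → a ℤ.* coeff (drop k h) n) (Listₚ.length-reverse g) ⟩
      a ℤ.* coeff (drop k h) (length g)            ≡⟨ ≡.cong (a ℤ.*_) (coeff-drop k h (length g)) ⟩
      a ℤ.* coeff h (k ℕ.+ length g)               ≡⟨ ≡.cong (λ n → a ℤ.* coeff h n) (ℕₚ.+-comm k (length g)) ⟩
      a ℤ.* coeff h (length g ℕ.+ k)               ≡⟨ coeff-scale a h (length g ℕ.+ k) ⟨
      coeff (scale a h) (length g ℕ.+ k)           ∎

  drop-coeff : ∀ r h → r ℕ.< length h → drop r h ≡ coeff h r ∷ drop (suc r) h
  drop-coeff zero    (b ∷ h) lt       = refl
  drop-coeff (suc r) (b ∷ h) (s≤s lt) = drop-coeff r h lt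

  -- After i steps the accumulator holds the i highest coefficients of the quotient, in the order of h.
  divLoop-correct : ∀ a b len h → (∀ r i → suc r ℕ.+ i ≡ length h → coeff a i ≡ dot (+ 1 ∷ b) (drop r h)) →
    ∀ r i → r ℕ.+ i ≡ length h → divLoop a (+ 1 ∷ b) len r i (drop r h) ≡ reverse h
  divLoop-correct a b len h hyp zero    i eq = refl
  divLoop-correct a b len h hyp (suc r) i eq = ≡.trans
    (≡.cong (divLoop a (+ 1 ∷ b) len r (suc i)) step)
    (divLoop-correct a b len h hyp r (suc i) (≡.trans (ℕₚ.+-suc r i) eq))
    where
    split : drop r h ≡ coeff h r ∷ drop (suc r) h
    split = drop-coeff r h (≡.subst (r ℕ.<_) eq (s≤s (ℕₚ.m≤m+n r i)))
    t = dot b (drop (suc r) h)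
    value : coeff a i ℤ.- t ≡ coeff h r
    value = begin
      coeff a i ℤ.- t                              ≡⟨ ≡.cong (ℤ._- t) (≡.trans (hyp r i eq) (≡.cong (dot (+ 1 ∷ b)) split)) ⟩
      (+ 1 ℤ.* coeff h r ℤ.+ t) ℤ.- t              ≡⟨ 𝓡.solve 2 (λ x t → (𝓡.con (+ 1) 𝓡.:* x 𝓡.:+ t) 𝓡.:- t 𝓡.:= x) refl (coeff h r) t ⟩
      coeff h r                                    ∎
      where open ≡.≡-Reasoning
    step : (coeff a i ℤ.- t) ∷ drop (suc r) h ≡ drop r h
    step = ≡.trans (≡.cong (_∷ drop (suc r) h) value) (≡.sym split)

  ++0 : ∀ p → p ++ + 0 ∷ [] ≋ p
  ++0 []      = 0∷0
  ++0 (a ∷ p) = ∷-cong refl (++0 p)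

  reverse-dropWhile : ∀ q → reverse (dropWhile (ℤ._≟ + 0) q) ≋ reverse q
  reverse-dropWhile []      = ≋-refl
  reverse-dropWhile (a ∷ q) with a ℤ.≟ + 0
  ... | no  _    = ≋-refl
  ... | yes refl = ≋-trans (reverse-dropWhile q)
    (≋-trans (≋-sym (++0 (reverse q))) (≡⇒≋ (≡.sym (Listₚ.unfold-reverse (+ 0) q))))

  strip-≋ : ∀ p → strip p ≋ p
  strip-≋ p = ≋-trans (reverse-dropWhile (reverse p)) (≡⇒≋ (Listₚ.reverse-involutive p))

  dropWhile-head : ∀ q → dropWhile (ℤ._≟ + 0) q ≡ [] ⊎ ∃ λ a → ∃ λ r → dropWhile (ℤ._≟ + 0) q ≡ a ∷ r × a ≢ + 0
  dropWhile-head []      = inj₁ refl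
  dropWhile-head (a ∷ q) with a ℤ.≟ + 0
  ... | no  a≢0  = inj₂ (a , q , refl , a≢0)
  ... | yes refl = dropWhile-head q

  -- The last entry left by `strip` is nonzero. Below position `n` it would leave no room for the
  -- leading 1, and above `n` it would contradict monicity, so it sits at `n` and is 1.
  strip-monic : ∀ {n p} → Monic n p → ∃ λ r → reverse (strip p) ≡ + 1 ∷ r × length (strip p) ≡ suc n
  strip-monic {n} {p} mp with dropWhile-head (reverse p)
  ... | inj₁ eq with () ← ≡.trans (≡.sym (lead mp)) (≡.trans (≡.sym (at (strip-≋ p) n)) (≡.cong (λ q → coeff (reverse q) n) eq))
  ... | inj₂ (a , r , eq , a≢0) = r , ≡.trans rev (≡.cong (_∷ r) a≡1) , ≡.trans len (≡.cong suc len-r)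
    where
    rev : reverse (strip p) ≡ a ∷ r
    rev = ≡.trans (Listₚ.reverse-involutive _) eq
    strip≡ : strip p ≡ reverse r ++ a ∷ []
    strip≡ = ≡.trans (≡.cong reverse eq) (Listₚ.unfold-reverse a r)
    len : length (strip p) ≡ suc (length r)
    len = ≡.trans (≡.cong (λ q → length (reverse q)) eq) (Listₚ.length-reverse (a ∷ r))
    last : coeff p (length r) ≡ a
    last = ≡.trans (≡.sym (at (strip-≋ p) (length r))) (≡.trans (≡.cong (λ q → coeff q (length r)) strip≡) (coeff-last r a))
    len-r : length r ≡ n
    len-r with ℕₚ.<-cmp (length r) n
    ... | tri< lt _ _ with () ← ≡.trans (≡.sym (lead mp)) (≡.trans (≡.sym (at (strip-≋ p) n))
                              (coeff-length (strip p) n (≡.subst (ℕ._≤ n) (≡.sym len) lt)))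
    ... | tri≈ _ e _ = e
    ... | tri> _ _ gt = ⊥-elim (a≢0 (≡.trans (≡.sym last) (above mp _ gt)))
    a≡1 : a ≡ + 1
    a≡1 = ≡.trans (≡.sym last) (≡.trans (≡.cong (coeff p) len-r) (lead mp))

  zero-ideal : IsIdeal (_≡ + 0)
  zero-ideal = record
    { J-cong = λ e z → ≡.trans (≡.sym e) z ; J-0 = refl
    ; J-+ = λ { refl refl → refl } ; J-* = λ { r refl → ℤₚ.*-zeroʳ r } }

  module Zero = MonicQuotient zero-ideal

  monic-≢0 : ∀ {n p} → Monic n p → p ≋ [] → ∀ {A : Set} → A
  monic-≢0 {n} mp e with () ← ≡.trans (≡.sym (lead mp)) (at e n)

  monic-deg-≤ : ∀ {F G f g h} → Monic F f → Monic G g → f ≋ g *P h → G ℕ.≤ F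
  monic-deg-≤ {F} {G} {f} {g} {h} mf mg eq with ℕₚ.≤-<-connex G F
  ... | inj₁ le = le
  ... | inj₂ lt = monic-≢0 mf (≋-trans eq (≋-trans (*P-congˡ g h≋0) (*P-zeroʳ g)))
    where
    h≋0 : h ≋ []
    h≋0 = mk λ i → Zero.monic-quotient mg h 0
      (λ j _ → ≡.trans (≡.sym (at eq (G ℕ.+ j))) (above mf _ (ℕₚ.<-≤-trans lt (ℕₚ.m≤m+n G j)))) i z≤n

  quotient-above : ∀ {F G f g h} → Monic F f → Monic G g → f ≋ g *P h →
    ∀ i → F ℕ.∸ G ℕ.< i → coeff h i ≡ + 0
  quotient-above {F} {G} {f} {g} {h} mf mg eq i lt = Zero.monic-quotient mg h (suc (F ℕ.∸ G))
    (λ j le → ≡.trans (≡.sym (at eq (G ℕ.+ j))) (above mf _ (bound j le))) i lt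
    where
    bound : ∀ j → F ℕ.∸ G ℕ.< j → F ℕ.< G ℕ.+ j
    bound j le = ℕₚ.<-≤-trans (s≤s (ℕₚ.m≤n+m∸n F G)) (≡.subst (ℕ._≤ G ℕ.+ j) (ℕₚ.+-suc G _) (ℕₚ.+-monoʳ-≤ G le))

  quotient-monic : ∀ {F G f g h} → Monic F f → Monic G g → f ≋ g *P h → Monic (F ℕ.∸ G) h
  quotient-monic {F} {G} {f} {g} {h} mf mg eq = record
    { lead = begin
        coeff h (F ℕ.∸ G)                        ≡⟨ ℤₚ.*-identityˡ _ ⟨
        + 1 ℤ.* coeff h (F ℕ.∸ G)                ≡⟨ ≡.cong (ℤ._* coeff h (F ℕ.∸ G)) (lead mg) ⟨
        coeff g G ℤ.* coeff h (F ℕ.∸ G)          ≡⟨ coeff-*-top G (F ℕ.∸ G) g h (above mg) (quotient-above mf mg eq) ⟨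
        coeff (g *P h) (G ℕ.+ (F ℕ.∸ G))         ≡⟨ at eq _ ⟨
        coeff f (G ℕ.+ (F ℕ.∸ G))                ≡⟨ ≡.cong (coeff f) (ℕₚ.m+[n∸m]≡n (monic-deg-≤ mf mg eq)) ⟩
        coeff f F                                ≡⟨ lead mf ⟩
        + 1                                      ∎
    ; above = quotient-above mf mg eq }
    where open ≡.≡-Reasoning

  -- The loop is compared with a list, not with a polynomial up to trailing zeros: `h'` is the
  -- quotient cut to exactly D + 1 entries, and the accumulator of the loop is always some
  -- `drop r h'`.
  exactDiv-correct : ∀ {F G f g h} → Monic F f → Monic G g → f ≋ g *P h → exactDiv f g ≋ h
  exactDiv-correct {F} {G} {f} {g} {h} mf mg eq with strip-monic mf | strip-monic mg
  ... | _ , _ , len-f | b , rev-g , len-g = ≋-trans (≡⇒≋ run) h'≋h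
    where
    open ≡.≡-Reasoning
    f' = strip f
    g' = strip g
    D = F ℕ.∸ G
    h' = applyUpTo (coeff h) (suc D)
    h'≋h : h' ≋ h
    h'≋h = mk (coeff-applyUpTo (coeff h) (suc D) (quotient-above mf mg eq))
    len-h : length h' ≡ suc D
    len-h = Listₚ.length-applyUpTo (coeff h) (suc D)
    f'≋ : f' ≋ g' *P h'
    f'≋ = ≋-trans (strip-≋ f) (≋-trans eq (*P-cong (≋-sym (strip-≋ g)) (≋-sym h'≋h)))
    index : ∀ r i → suc r ℕ.+ i ≡ length h' → suc (i ℕ.+ (length g' ℕ.∸ 1 ℕ.+ r)) ≡ length f'
    index r i e = begin
      suc (i ℕ.+ (length g' ℕ.∸ 1 ℕ.+ r))  ≡⟨ ≡.cong (λ n → suc (i ℕ.+ (n ℕ.∸ 1 ℕ.+ r))) len-g ⟩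
      suc (i ℕ.+ (G ℕ.+ r))                ≡⟨ ≡.cong suc (ℕₚ.+-comm i (G ℕ.+ r)) ⟩
      suc (G ℕ.+ r ℕ.+ i)                  ≡⟨ ≡.cong suc (ℕₚ.+-assoc G r i) ⟩
      suc (G ℕ.+ (r ℕ.+ i))                ≡⟨ ≡.cong (λ n → suc (G ℕ.+ n)) (ℕₚ.suc-injective (≡.trans e len-h)) ⟩
      suc (G ℕ.+ D)                        ≡⟨ ≡.cong suc (ℕₚ.m+[n∸m]≡n (monic-deg-≤ mf mg eq)) ⟩
      suc F                                ≡⟨ len-f ⟨
      length f'                            ∎
    hyp : ∀ r i → suc r ℕ.+ i ≡ length h' → coeff (reverse f') i ≡ dot (+ 1 ∷ b) (drop r h')
    hyp r i e = begin
      coeff (reverse f') i                              ≡⟨ coeff-reverse f' i (length g' ℕ.∸ 1 ℕ.+ r) (index r i e) ⟩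
      coeff f' (length g' ℕ.∸ 1 ℕ.+ r)                  ≡⟨ at f'≋ _ ⟩
      coeff (g' *P h') (length g' ℕ.∸ 1 ℕ.+ r)          ≡⟨ dot-reverse g' h' r ⟨
      dot (reverse g') (drop r h')                      ≡⟨ ≡.cong (λ x → dot x (drop r h')) rev-g ⟩
      dot (+ 1 ∷ b) (drop r h')                         ∎
    run : exactDiv f g ≡ h'
    run = begin
      reverse (divLoop (reverse f') (reverse g') (suc r₀) (suc r₀) 0 [])
        ≡⟨ ≡.cong₂ (λ x n → reverse (divLoop (reverse f') x (suc r₀) n 0 [])) rev-g r₀≡ ⟩
      reverse (divLoop (reverse f') (+ 1 ∷ b) (suc r₀) (length h') 0 [])
        ≡⟨ ≡.cong (λ hs → reverse (divLoop (reverse f') (+ 1 ∷ b) (suc r₀) (length h') 0 hs)) (Listₚ.drop-all (length h') h' ℕₚ.≤-refl) ⟨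
      reverse (divLoop (reverse f') (+ 1 ∷ b) (suc r₀) (length h') 0 (drop (length h') h'))
        ≡⟨ ≡.cong reverse (divLoop-correct (reverse f') b (suc r₀) h' hyp (length h') 0 (ℕₚ.+-identityʳ _)) ⟩
      reverse (reverse h')
        ≡⟨ Listₚ.reverse-involutive h' ⟩
      h' ∎
      where
      r₀ = length f' ℕ.∸ length g'
      r₀≡ : suc r₀ ≡ length h'
      r₀≡ = ≡.trans (≡.cong₂ (λ x y → suc (x ℕ.∸ y)) len-f len-g) (≡.sym len-h)

  open import Data.List.Relation.Unary.All as All using ([]; _∷_)
  open import Data.List.Relation.Unary.AllPairs using (AllPairs; []; _∷_)

  -- Cancellation and torsion modulo monic polynomials.

  monic-cancel : ∀ {n g a b} → Monic n g → g *P a ≋ g *P b → a ≋ b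
  monic-cancel {n} {g} {a} {b} mg eq = begin
    a                  ≈⟨ solve 2 (λ a b → a := (a :- b) :+ b) ≋-refl a b ⟩
    (a +P (-P b)) +P b ≈⟨ +P-congʳ b difference ⟩
    b                  ∎
    where
    open ≋-Reasoning
    vanish : g *P (a +P (-P b)) ≋ []
    vanish = begin
      g *P (a +P (-P b))             ≈⟨ solve 3 (λ g a b → g :* (a :- b) := g :* a :- g :* b) ≋-refl g a b ⟩
      (g *P a) +P (-P (g *P b))      ≈⟨ +P-congʳ (-P (g *P b)) eq ⟩
      (g *P b) +P (-P (g *P b))      ≈⟨ -P-inverseʳ (g *P b) ⟩
      []                             ∎
    difference : a +P (-P b) ≋ []
    difference = mk λ i → Zero.monic-quotient mg (a +P (-P b)) 0 (λ j _ → at vanish (n ℕ.+ j)) i z≤n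

  multiple-ideal : ∀ M → IsIdeal (λ a → ∃ λ c → a ≡ M ℤ.* c)
  multiple-ideal M = record
    { J-cong = λ { refl z → z }
    ; J-0    = + 0 , ≡.sym (ℤₚ.*-zeroʳ M)
    ; J-+    = λ { (c , refl) (d , refl) → c ℤ.+ d , ≡.sym (ℤₚ.*-distribˡ-+ M c d) }
    ; J-*    = λ { r (c , refl) → r ℤ.* c , 𝓡.solve 3 (λ r m c → r 𝓡.:* (m 𝓡.:* c) 𝓡.:= m 𝓡.:* (r 𝓡.:* c)) refl r M c } }

  -- ℤ[x]/(g) is torsion-free for monic `g`: if g h = (k + 1) f, then all coefficients of `h` are
  -- multiples of k + 1, and that integer cancels on both sides.
  monic-torsion : ∀ {g f n} k → Monic n g → g ∣P scale (+ suc k) f → g ∣P f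
  monic-torsion {g} {f} {n} k mg (dividesP h eq) with split h multiples
    where
    M = + suc k
    module Multiple = MonicQuotient (multiple-ideal M)
    multiples : ∀ i → ∃ λ c → coeff h i ≡ M ℤ.* c
    multiples i = Multiple.monic-quotient mg h 0
      (λ j _ → coeff f (n ℕ.+ j) , ≡.trans (≡.sym (at eq (n ℕ.+ j))) (coeff-scale M f (n ℕ.+ j))) i z≤n
    split : ∀ h → (∀ i → ∃ λ c → coeff h i ≡ M ℤ.* c) → ∃ λ h' → h ≋ scale M h'
    split []      z = [] , ≋-refl
    split (a ∷ h) z with z 0 | split h (λ i → z (suc i))
    ... | c , e | h' , e' = c ∷ h' , ∷-cong e e'
  ... | h' , eq' = dividesP h' (mk λ i → ℤₚ.*-cancelˡ-≡ M (coeff f i) (coeff (g *P h') i) (begin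
      M ℤ.* coeff f i                ≡⟨ coeff-scale M f i ⟨
      coeff (scale M f) i            ≡⟨ at scaled i ⟩
      coeff (scale M (g *P h')) i    ≡⟨ coeff-scale M (g *P h') i ⟩
      M ℤ.* coeff (g *P h') i        ∎))
    where
    open ≡.≡-Reasoning
    M = + suc k
    scaled : scale M f ≋ scale M (g *P h')
    scaled = ≋-trans eq (≋-trans (*P-congˡ g eq') (≋-trans (*P-comm g (scale M h'))
      (≋-trans (scale-*P M h' g) (scale-cong {M} refl (*P-comm h' g)))))

  -- Geometric sums and the polynomials x^n - 1.

  geo : Poly → ℕ → Poly
  geo y zero    = 0P
  geo y (suc r) = 1P +P (y *P geo y r)

  geo-* : ∀ y r → (y +P (-P 1P)) *P geo y r ≋ (y ^P r) +P (-P 1P)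
  geo-* y zero    = ≋-trans (*P-zeroʳ (y +P (-P 1P))) (≋-sym (-P-inverseʳ 1P))
  geo-* y (suc r) = begin
    (y +P (-P 1P)) *P (1P +P (y *P geo y r))
      ≈⟨ solve 2 (λ y s → (y :- con (+ 1)) :* (con (+ 1) :+ y :* s) := (y :- con (+ 1)) :+ y :* ((y :- con (+ 1)) :* s)) ≋-refl y (geo y r) ⟩
    (y +P (-P 1P)) +P (y *P ((y +P (-P 1P)) *P geo y r))
      ≈⟨ +P-congˡ (y +P (-P 1P)) (*P-congˡ y (geo-* y r)) ⟩
    (y +P (-P 1P)) +P (y *P ((y ^P r) +P (-P 1P)))
      ≈⟨ solve 2 (λ y p → (y :- con (+ 1)) :+ y :* (p :- con (+ 1)) := y :* p :- con (+ 1)) ≋-refl y (y ^P r) ⟩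
    (y *P (y ^P r)) +P (-P 1P) ∎
    where open ≋-Reasoning

  geo-mod : ∀ y r → ∃ λ u → geo y r ≋ const (+ r) +P ((y +P (-P 1P)) *P u)
  geo-mod y zero = [] , ≋-sym (≋-trans (+P-cong 0∷0 (*P-zeroʳ (y +P (-P 1P)))) ≋-refl)
  geo-mod y (suc r) with geo-mod y r
  ... | u , eq = const (+ r) +P (y *P u) , (begin
    1P +P (y *P geo y r)
      ≈⟨ +P-congˡ 1P (*P-congˡ y eq) ⟩
    1P +P (y *P (const (+ r) +P ((y +P (-P 1P)) *P u)))
      ≈⟨ solve 3 (λ y c u → con (+ 1) :+ y :* (c :+ (y :- con (+ 1)) :* u) := (con (+ 1) :+ c) :+ (y :- con (+ 1)) :* (c :+ y :* u)) ≋-refl y (const (+ r)) u ⟩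
    (1P +P const (+ r)) +P ((y +P (-P 1P)) *P (const (+ r) +P (y *P u))) ∎)
    where open ≋-Reasoning

  xN-1-+ : ∀ m n → xN-1 (m ℕ.+ n) ≋ ((X ^P m) *P xN-1 n) +P xN-1 m
  xN-1-+ m n = ≋-trans (+P-congʳ (-P 1P) (^P-+ X m n))
    (solve 2 (λ a b → a :* b :- con (+ 1) := a :* (b :- con (+ 1)) :+ (a :- con (+ 1))) ≋-refl (X ^P m) (X ^P n))

  xN-1-* : ∀ g r → xN-1 (g ℕ.* r) ≋ xN-1 g *P geo (X ^P g) r
  xN-1-* g r = ≋-trans (+P-congʳ (-P 1P) (^P-* X g r)) (≋-sym (geo-* (X ^P g) r))

  xN-1-∣ : ∀ {d e} → d ∣ e → xN-1 d ∣P xN-1 e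
  xN-1-∣ {d} (divides q refl) = dividesP (geo (X ^P d) q) (≋-trans (≡⇒≋ (≡.cong xN-1 (ℕₚ.*-comm q d))) (xN-1-* d q))

  xN-1-monic : ∀ {e} → 0 ℕ.< e → Monic e (xN-1 e)
  xN-1-monic {suc n} _ = record
    { lead  = ≡.trans (coeff-+ (X ^P suc n) (-P 1P) (suc n)) (≡.trans (ℤₚ.+-identityʳ _) (lead (X^-monic (suc n))))
    ; above = above' }
    where
    X-monic : Monic 1 X
    X-monic = record { lead = refl ; above = λ { (suc zero) (s≤s ()) ; (suc (suc i)) _ → refl } }
    X^-monic : ∀ n → Monic n (X ^P n)
    X^-monic zero    = record { lead = refl ; above = λ { (suc i) _ → refl } }
    X^-monic (suc n) = Monic-* X-monic (X^-monic n)
    above' : ∀ i → suc n ℕ.< i → coeff (xN-1 (suc n)) i ≡ + 0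
    above' (suc i) lt = ≡.trans (coeff-+ (X ^P suc n) (-P 1P) (suc i)) (≡.trans (ℤₚ.+-identityʳ _) (above (X^-monic (suc n)) (suc i) lt))

  -- The exponents m with A ∣ f (x^m − 1) are closed under sums and differences, hence under gcds.
  module _ (A f : Poly) where
    private
      S : ℕ → Set
      S m = A ∣P f *P xN-1 m

    annihilator-+ : ∀ m n → S m → S n → S (m ℕ.+ n)
    annihilator-+ m n sm sn = ∣P-cong
      (≋-trans (solve 4 (λ f x a b → x :* (f :* a) :+ f :* b := f :* (x :* a :+ b)) ≋-refl f (X ^P m) (xN-1 n) (xN-1 m))
               (*P-congˡ f (≋-sym (xN-1-+ m n))))
      (∣P-+ (∣P-*ˡ (X ^P m) sn) sm)

    annihilator-∸ : ∀ m n → S (n ℕ.+ m) → S m → S n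
    annihilator-∸ m n snm sm = ∣P-cong
      (≋-trans (+P-congʳ ((-P (X ^P n)) *P (f *P xN-1 m)) (*P-congˡ f (xN-1-+ n m)))
               (solve 4 (λ f x a b → f :* (x :* a :+ b) :+ (:- x) :* (f :* a) := f :* b) ≋-refl f (X ^P n) (xN-1 m) (xN-1 n)))
      (∣P-+ snm (∣P-*ˡ (-P (X ^P n)) sm))

    annihilator-* : ∀ m k → S m → S (k ℕ.* m)
    annihilator-* m zero    sm = dividesP 0P (≋-trans (*P-congˡ f (-P-inverseʳ 1P)) (≋-trans (*P-zeroʳ f) (≋-sym (*P-zeroʳ A))))
    annihilator-* m (suc k) sm = annihilator-+ m (k ℕ.* m) sm (annihilator-* m k sm)

    annihilator-gcd : ∀ m n → S m → S n → S (gcd m n)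
    annihilator-gcd m n sm sn with Bézout.identity (gcd-GCD m n)
    ... | Bézout.+- x y eq = annihilator-∸ (y ℕ.* n) (gcd m n) (≡.subst S (≡.sym eq) (annihilator-* m x sm)) (annihilator-* n y sn)
    ... | Bézout.-+ x y eq = annihilator-∸ (x ℕ.* m) (gcd m n) (≡.subst S (≡.sym eq) (annihilator-* n y sn)) (annihilator-* m x sm)

  -- Proper divisors, the recursion for `Φ`, and the induction on the index.

  ∈-properDivisors⁻ : ∀ {N d} → d ∈ properDivisors N → 0 ℕ.< d × d ℕ.< N × d ∣ N
  ∈-properDivisors⁻ {zero}  ()
  ∈-properDivisors⁻ {suc n} d∈ with ∈-filter⁻ (_∣? suc n) {xs = map suc (upTo n)} d∈
  ... | d∈' , d∣N with ∈-map⁻ suc d∈'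
  ... | i , i∈ , refl = s≤s z≤n , s≤s (∈-upTo⁻ i∈) , d∣N

  ∈-properDivisors⁺ : ∀ {N d} → 0 ℕ.< d → d ℕ.< N → d ∣ N → d ∈ properDivisors N
  ∈-properDivisors⁺ {suc n} {suc d} _ (s≤s d<n) d∣N = ∈-filter⁺ (_∣? suc n) (∈-map⁺ suc (∈-upTo⁺ d<n)) d∣N

  properDivisors-increasing : ∀ N → AllPairs ℕ._<_ (properDivisors N)
  properDivisors-increasing N = AllPairsₚ.filter⁺ (_∣? N)
    (AllPairsₚ.map⁺ (AllPairsₚ.applyUpTo⁺₁ _ (N ℕ.∸ 1) (λ i<j _ → s≤s i<j)))

  ΠΦ : List ℕ → Poly
  ΠΦ []       = 1P
  ΠΦ (d ∷ ds) = Φ d *P ΠΦ ds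

  prodCyc-ΠΦ : ∀ n ds → (∀ {d} → d ∈ ds → cycAux n d ≡ Φ d) → prodCyc n ds ≡ ΠΦ ds
  prodCyc-ΠΦ n []       h = refl
  prodCyc-ΠΦ n (d ∷ ds) h = ≡.cong₂ _*P_ (h (here refl)) (prodCyc-ΠΦ n ds (λ d∈ → h (there d∈)))

  -- The recursion descends to proper divisors, which are smaller, so fuel from `N` on gives the
  -- same value. This is required because unfolding `Φ (suc n)` leaves its divisors with fuel `n`
  -- instead of their own index.
  cycAux-fuel : ∀ N → 0 ℕ.< N → ∀ n → N ℕ.≤ n → cycAux n N ≡ Φ N
  cycAux-fuel = <-rec _ step
    where
    step : ∀ N → (∀ {M} → M ℕ.< N → 0 ℕ.< M → ∀ n → M ℕ.≤ n → cycAux n M ≡ Φ M) →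
      0 ℕ.< N → ∀ n → N ℕ.≤ n → cycAux n N ≡ Φ N
    step (suc N) rec 0<N (suc n) (s≤s N≤n) = ≡.cong (exactDiv (xN-1 (suc N)))
      (≡.trans (prodCyc-ΠΦ n (properDivisors (suc N)) (λ d∈ → same n N≤n (∈-properDivisors⁻ d∈)))
        (≡.sym (prodCyc-ΠΦ N (properDivisors (suc N)) (λ d∈ → same N ℕₚ.≤-refl (∈-properDivisors⁻ d∈)))))
      where
      same : ∀ k → N ℕ.≤ k → ∀ {d} → 0 ℕ.< d × d ℕ.< suc N × d ∣ suc N → cycAux k d ≡ Φ d
      same k N≤k (0<d , s≤s d≤N , _) = rec (s≤s d≤N) 0<d k (ℕₚ.≤-trans d≤N N≤k)

  Φ-exactDiv : ∀ {e} → 0 ℕ.< e → Φ e ≡ exactDiv (xN-1 e) (ΠΦ (properDivisors e))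
  Φ-exactDiv {suc n} _ = ≡.cong (exactDiv (xN-1 (suc n))) (prodCyc-ΠΦ n (properDivisors (suc n)) λ d∈ →
    let (0<d , d<N , _) = ∈-properDivisors⁻ d∈ in cycAux-fuel _ 0<d n (ℕₚ.≤-pred d<N))

  -- `B` is a non-zero-divisor modulo `A`. Comaximality would be too strong over ℤ: x - 1 and x + 1
  -- generate an ideal that contains 2 but not 1.
  Cancels : Poly → Poly → Set
  Cancels A B = ∀ f → A ∣P f *P B → A ∣P f

  ∈-ΠΦ-∣ : ∀ {d ds} → d ∈ ds → Φ d ∣P ΠΦ ds
  ∈-ΠΦ-∣ {ds = d ∷ ds} (here refl) = ∣P-*ʳ (ΠΦ ds) ∣P-refl
  ∈-ΠΦ-∣ {ds = e ∷ ds} (there d∈)  = ∣P-*ˡ (Φ e) (∈-ΠΦ-∣ d∈)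

  Cancels-ΠΦ : ∀ {A} ds → (∀ {d} → d ∈ ds → Cancels A (Φ d)) → Cancels A (ΠΦ ds)
  Cancels-ΠΦ []       c f d = ∣P-cong (CommutativeRing.*-identityʳ ring≋ f) d
  Cancels-ΠΦ (e ∷ ds) c f d = c (here refl) f (Cancels-ΠΦ ds (λ d∈ → c (there d∈)) (f *P Φ e)
    (∣P-cong (≋-sym (*P-assoc f (Φ e) (ΠΦ ds))) d))

  -- After writing f = Φ_d u, every later Φ_e divides Φ_d u, and Φ_d is cancellable modulo Φ_e, so
  -- Φ_e divides `u`. Hence one direction of cancellability, for earlier against later entries, is
  -- what the list carries.
  ΠΦ-∣ : ∀ ds f → AllPairs (λ d e → Cancels (Φ e) (Φ d)) ds → (∀ {d} → d ∈ ds → Φ d ∣P f) → ΠΦ ds ∣P f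
  ΠΦ-∣ []       f cs       h = dividesP f (≋-sym (CommutativeRing.*-identityˡ ring≋ f))
  ΠΦ-∣ (d ∷ ds) f (c ∷ cs) h with h (here refl)
  ... | dividesP u eq with ΠΦ-∣ ds u cs (λ e∈ → All.lookup c e∈ u (∣P-cong (≋-trans eq (*P-comm (Φ d) u)) (h (there e∈))))
  ... | dividesP v eq' = dividesP v (≋-trans eq (≋-trans (*P-congˡ (Φ d) eq') (≋-sym (*P-assoc (Φ d) (ΠΦ ds) v))))

  -- The geometric sum (x^(gr) − 1)/(x^g − 1) is congruent to r modulo x^g − 1, so A ∣ f (x^g − 1) gives A ∣ r f.
  Cancels-xN-1 : ∀ {n A} k g → Monic n A → A ∣P geo (X ^P g) (suc k) → Cancels A (xN-1 g)
  Cancels-xN-1 {n} {A} k g monic A∣geo f A∣f = by-mod (geo-mod (X ^P g) (suc k))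
    where
    c = const (+ suc k)
    by-mod : (∃ λ u → geo (X ^P g) (suc k) ≋ c +P (xN-1 g *P u)) → A ∣P f
    by-mod (u , mod) = monic-torsion k monic (∣P-cong rearrange
        (∣P-+ (∣P-*ˡ f A∣geo) (∣P-*ˡ (-P u) A∣f)))
      where
      open ≋-Reasoning
      rearrange : (f *P geo (X ^P g) (suc k)) +P ((-P u) *P (f *P xN-1 g)) ≋ scale (+ suc k) f
      rearrange = begin
        (f *P geo (X ^P g) (suc k)) +P ((-P u) *P (f *P xN-1 g))
          ≈⟨ +P-congʳ ((-P u) *P (f *P xN-1 g)) (*P-congˡ f mod) ⟩
        (f *P (c +P (xN-1 g *P u))) +P ((-P u) *P (f *P xN-1 g))
          ≈⟨ solve 4 (λ f c y u → f :* (c :+ y :* u) :+ (:- u) :* (f :* y) := c :* f) ≋-refl f c (xN-1 g) u ⟩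
        c *P f
          ≈⟨ const-* (+ suc k) f ⟩
        scale (+ suc k) f ∎

  -- `geometric` is the invariant that drives the induction: Φ_e still divides (x^e - 1)/(x^g - 1)
  -- for each proper divisor g = e/r. Modulo x^g - 1 this quotient becomes the integer `r`, which
  -- makes x^g - 1 cancellable modulo Φ_e.
  record Cyclotomic (e : ℕ) : Set where
    field
      degree    : ℕ
      monic     : Monic degree (Φ e)
      factor    : xN-1 e ≋ Φ e *P ΠΦ (properDivisors e)
      geometric : ∀ g r → g ℕ.* r ≡ e → 1 ℕ.< r → Φ e ∣P geo (X ^P g) r

    Φ-∣ : Φ e ∣P xN-1 e
    Φ-∣ = dividesP (ΠΦ (properDivisors e)) factor

    -- If Φ_e divides f (x^d - 1), it also divides f (x^e - 1), hence f (x^g - 1) with g = gcd(d,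
    -- e). As e does not divide d, `g` is a proper divisor of `e`, and `geometric` applies to it.
    Φ-cancels : ∀ {d} → 0 ℕ.< e → ¬ e ∣ d → Cancels (Φ e) (xN-1 d)
    Φ-cancels {d} 0<e e∤d f Φ∣ = by-quotient (gcd[m,n]∣n d e)
      where
      by-quotient : gcd d e ∣ e → Φ e ∣P f
      by-quotient (divides zero          eq) = ⊥-elim (ℕₚ.<⇒≢ 0<e (≡.sym eq))
      by-quotient (divides (suc zero)    eq) =
        ⊥-elim (e∤d (≡.subst (_∣ d) (≡.sym (≡.trans eq (ℕₚ.+-identityʳ _))) (gcd[m,n]∣m d e)))
      by-quotient (divides (suc (suc k)) eq) = Cancels-xN-1 (suc k) (gcd d e) monic
        (geometric (gcd d e) (suc (suc k)) (≡.trans (ℕₚ.*-comm (gcd d e) (suc (suc k))) (≡.sym eq)) (s≤s (s≤s z≤n)))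
        f (annihilator-gcd (Φ e) f d e Φ∣ (∣P-*ˡ f Φ-∣))

  open Cyclotomic public

  -- The division that defines Φ_e is exact only if `Pr` divides x^e - 1. By induction each factor
  -- of `Pr` does, and an earlier factor is cancellable modulo a later one, so the whole product
  -- does.
  cyclotomic : ∀ e → 0 ℕ.< e → Cyclotomic e
  cyclotomic = <-rec _ step
    where
    step : ∀ e → (∀ {d} → d ℕ.< e → 0 ℕ.< d → Cyclotomic d) → 0 ℕ.< e → Cyclotomic e
    step e rec 0<e = record
      { degree = e ℕ.∸ proj₁ ΠΦ-monic ; monic = monic' ; factor = factor' ; geometric = geometric' }
      where
      Pr = ΠΦ (properDivisors e)

      below : ∀ {g} → g ℕ.≤ e → ∀ {d} → d ∈ properDivisors g → Cyclotomic d
      below g≤e d∈ = let (0<d , d<g , _) = ∈-properDivisors⁻ d∈ in rec (ℕₚ.<-≤-trans d<g g≤e) 0<d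

      -- Φ_d divides x^d - 1, which is cancellable modulo Φ_{d'} because d < d' excludes d' ∣ d; a
      -- factor of a cancellable polynomial is cancellable.
      Φ-cancels-Φ : ∀ {d d'} → Cyclotomic d → Cyclotomic d' → 0 ℕ.< d → d ℕ.< d' → Cancels (Φ d') (Φ d)
      Φ-cancels-Φ {d} {d'} cd cd' 0<d d<d' f Φ∣ =
        Φ-cancels cd' (ℕₚ.<-trans 0<d d<d') (λ d'∣d → ℕₚ.<⇒≱ d<d' (∣⇒≤ {{ℕ.>-nonZero 0<d}} d'∣d)) f
          (∣P-cong (≋-trans (*P-assoc f (Φ d) (ΠΦ (properDivisors d))) (*P-congˡ f (≋-sym (factor cd)))) (∣P-*ʳ (ΠΦ (properDivisors d)) Φ∣))

      pairs : ∀ {g} → g ℕ.≤ e → AllPairs (λ d d' → Cancels (Φ d') (Φ d)) (properDivisors g)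
      pairs {g} g≤e = go (properDivisors g) (λ d∈ → below g≤e d∈ , proj₁ (∈-properDivisors⁻ {g} d∈)) (properDivisors-increasing g)
        where
        go : ∀ ds → (∀ {d} → d ∈ ds → Cyclotomic d × 0 ℕ.< d) → AllPairs ℕ._<_ ds → AllPairs (λ d d' → Cancels (Φ d') (Φ d)) ds
        go []       c []       = []
        go (d ∷ ds) c (p ∷ ps) = All.tabulate (λ d'∈ →
            Φ-cancels-Φ (proj₁ (c (here refl))) (proj₁ (c (there d'∈))) (proj₂ (c (here refl))) (All.lookup p d'∈))
          ∷ go ds (λ d∈ → c (there d∈)) ps

      product : Pr ∣P xN-1 e
      product = ΠΦ-∣ (properDivisors e) (xN-1 e) (pairs ℕₚ.≤-refl)
        (λ d∈ → ∣P-trans (Φ-∣ (below ℕₚ.≤-refl d∈)) (xN-1-∣ {e = e} (proj₂ (proj₂ (∈-properDivisors⁻ {e} d∈)))))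

      ΠΦ-monic : ∃ λ m → Monic m Pr
      ΠΦ-monic = go (properDivisors e) (below ℕₚ.≤-refl)
        where
        go : ∀ ds → (∀ {d} → d ∈ ds → Cyclotomic d) → ∃ λ m → Monic m (ΠΦ ds)
        go []       c = 0 , record { lead = refl ; above = λ { (suc i) _ → refl } }
        go (d ∷ ds) c with go ds (λ d∈ → c (there d∈))
        ... | m , mp = degree (c (here refl)) ℕ.+ m , Monic-* (monic (c (here refl))) mp

      Φ≋ : Φ e ≋ _∣P_.quotient product
      Φ≋ = ≋-trans (≡⇒≋ (Φ-exactDiv 0<e)) (exactDiv-correct (xN-1-monic 0<e) (proj₂ ΠΦ-monic) (_∣P_.equality product))

      monic' : Monic (e ℕ.∸ proj₁ ΠΦ-monic) (Φ e)
      monic' = Monic-cong (≋-sym Φ≋) (quotient-monic (xN-1-monic 0<e) (proj₂ ΠΦ-monic) (_∣P_.equality product))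

      factor' : xN-1 e ≋ Φ e *P Pr
      factor' = ≋-trans (_∣P_.equality product) (≋-trans (*P-congˡ Pr (≋-sym Φ≋)) (*P-comm Pr (Φ e)))

      -- Both `g` and its proper divisors are proper divisors of `e`, so `Πg` and Φ_g divide `Pr`.
      -- Since `Πg` is cancellable modulo Φ_g, even their product x^g - 1 does. Cancelling it from
      -- x^e - 1 = Φ_e · Pr leaves the geometric sum as a multiple of Φ_e.
      geometric' : ∀ g r → g ℕ.* r ≡ e → 1 ℕ.< r → Φ e ∣P geo (X ^P g) r
      geometric' g r eq 1<r = quotient
        where
        0<g : 0 ℕ.< g
        0<g = ℕₚ.n≢0⇒n>0 λ { refl → ℕₚ.<⇒≢ 0<e eq }
        g<e : g ℕ.< e
        g<e = ≡.subst₂ ℕ._<_ (ℕₚ.*-identityʳ g) eq (ℕₚ.*-monoʳ-< g {{ℕ.>-nonZero 0<g}} 1<r)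
        g∣e : g ∣ e
        g∣e = divides r (≡.trans (≡.sym eq) (ℕₚ.*-comm g r))
        cg : Cyclotomic g
        cg = rec g<e 0<g
        Πg = ΠΦ (properDivisors g)
        Πg∣Pr : Πg ∣P Pr
        Πg∣Pr = ΠΦ-∣ (properDivisors g) Pr (pairs (ℕₚ.<⇒≤ g<e)) λ d∈ →
          let (0<d , d<g , d∣g) = ∈-properDivisors⁻ d∈
          in ∈-ΠΦ-∣ (∈-properDivisors⁺ 0<d (ℕₚ.<-trans d<g g<e) (∣-trans d∣g g∣e))
        v = _∣P_.quotient Πg∣Pr
        Φg∣v : Φ g ∣P v
        Φg∣v = Cancels-ΠΦ (properDivisors g)
          (λ d∈ → let (0<d , d<g , _) = ∈-properDivisors⁻ d∈ in Φ-cancels-Φ (below (ℕₚ.<⇒≤ g<e) d∈) cg 0<d d<g) v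
          (∣P-cong (≋-trans (_∣P_.equality Πg∣Pr) (*P-comm Πg v)) (∈-ΠΦ-∣ (∈-properDivisors⁺ 0<g g<e g∣e)))
        w = _∣P_.quotient Φg∣v
        quotient : Φ e ∣P geo (X ^P g) r
        quotient = dividesP w (monic-cancel (xN-1-monic 0<g) (begin
          xN-1 g *P geo (X ^P g) r        ≈⟨ xN-1-* g r ⟨
          xN-1 (g ℕ.* r)                  ≈⟨ ≡⇒≋ (≡.cong xN-1 eq) ⟩
          xN-1 e                          ≈⟨ factor' ⟩
          Φ e *P Pr                       ≈⟨ *P-congˡ (Φ e) (_∣P_.equality Πg∣Pr) ⟩
          Φ e *P (Πg *P v)                ≈⟨ *P-congˡ (Φ e) (*P-congˡ Πg (_∣P_.equality Φg∣v)) ⟩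
          Φ e *P (Πg *P (Φ g *P w))       ≈⟨ solve 4 (λ e p g w → e :* (p :* (g :* w)) := (g :* p) :* (e :* w)) ≋-refl (Φ e) Πg (Φ g) w ⟩
          (Φ g *P Πg) *P (Φ e *P w)       ≈⟨ *P-congʳ (Φ e *P w) (factor cg) ⟨
          xN-1 g *P (Φ e *P w)            ∎))
          where open ≋-Reasoning

open Cyclotomy using (cyclotomic; Cancels; geo; xN-1-∣; Φ-∣; geometric; Φ-cancels)
open 𝕊 using (_≋_; at; mk; _∣P_; dividesP)
module 𝕊S = 𝕊.𝓟

-- The iterated polynomial ring plays two roles: ℤ[t][q], which contains the left-hand side, and
-- ℤ[q][x], which contains the generating functions Σ_m [n choose m]_q x^m.
open PolyRing 𝕊.polyRing renaming (_≋_ to _≋₂_; at to at₂; mk to mk₂)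
open PolyLemmas 𝕊.polyRing hiding (module 𝓟; module 𝓡; Monic; lead; above; _∣P_; dividesP)
open FiniteDifference 𝕊.polyRing
open IntegerSolver ring≋ using (solve; _:+_; _:*_; _:-_; :-_; _:=_; con)
open QBinomial ℤ-ring using (1-X^; qbinom-absorb; qbinom-recurrence; qbinom->; qbinom-diag)

-- The embedding of ℤ[q] into ℤ[t][q] and the functionals on ℤ[q][x].

coeff-liftZ : ∀ p i → coeff (liftZ p) i ≋ ZX.const (ZX.coeff p i)
coeff-liftZ []      i       = 𝕊.≋-sym 𝕊.0∷0
coeff-liftZ (a ∷ p) zero    = 𝕊.≋-refl
coeff-liftZ (a ∷ p) (suc i) = coeff-liftZ p i

liftZ-cong : ∀ {p q} → p ≋ q → liftZ p ≋₂ liftZ q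
liftZ-cong {p} {q} e = mk₂ λ i → at (𝕊.≋-trans (coeff-liftZ p i) (𝕊.≋-trans (𝕊.const-cong (at e i)) (𝕊.≋-sym (coeff-liftZ q i))))

liftZ-+ : ∀ p q → liftZ (p ZX.+P q) ≋₂ liftZ p +P liftZ q
liftZ-+ []      q       = ≋-refl
liftZ-+ (a ∷ p) []      = ≋-refl
liftZ-+ (a ∷ p) (b ∷ q) = ∷-cong (at (𝕊.≋-refl {ZX.const a ZX.+P ZX.const b})) (liftZ-+ p q)

liftZ-scale : ∀ a p → liftZ (ZX.scale a p) ≋₂ scale (ZX.const a) (liftZ p)
liftZ-scale a []      = ≋-refl
liftZ-scale a (b ∷ p) = ∷-cong (at (𝕊.const-*P a b)) (liftZ-scale a p)

liftZ-* : ∀ p q → liftZ (p ZX.*P q) ≋₂ liftZ p *P liftZ q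
liftZ-* []      q = ≋-refl
liftZ-* (a ∷ p) q = ≋-trans (liftZ-+ (ZX.scale a q) (+ 0 ∷ (p ZX.*P q)))
  (+P-cong (liftZ-scale a q) (∷-cong (at 𝕊.0∷0) (liftZ-* p q)))

liftZ-X^ : ∀ n → liftZ (ZX.X ZX.^P n) ≋₂ X ^P n
liftZ-X^ zero    = ≋-refl
liftZ-X^ (suc n) = ≋-trans (liftZ-* ZX.X (ZX.X ZX.^P n)) (*P-cong liftZ-X (liftZ-X^ n))
  where
  liftZ-X : liftZ ZX.X ≋₂ X
  liftZ-X = ∷-cong (at 𝕊.0∷0) ≋-refl

-- F ∈ ℤ[q][x] is mapped to Σ_m w^m φ(m) F_m.
module Functional (w : Poly) where

  L : (ℕ → ZX.Poly) → Poly → Poly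
  L φ []      = 0P
  L φ (f ∷ F) = (const (φ 0) *P liftZ f) +P (w *P L (λ m → φ (suc m)) F)

  L-[] : ∀ φ F → F ≋₂ [] → L φ F ≋₂ []
  L-[] φ []      e = ≋-refl
  L-[] φ (f ∷ F) e = begin
    (const (φ 0) *P liftZ f) +P (w *P L (λ m → φ (suc m)) F)
      ≈⟨ +P-cong (*P-congˡ (const (φ 0)) (liftZ-cong {f} {[]} (mk (at₂ e 0)))) (*P-congˡ w (L-[] (λ m → φ (suc m)) F (mk₂ λ i → at₂ e (suc i)))) ⟩
    (const (φ 0) *P []) +P (w *P [])
      ≈⟨ +P-cong (*P-zeroʳ (const (φ 0))) (*P-zeroʳ w) ⟩
    [] ∎
    where open ≋-Reasoning

  L-cong : ∀ φ F F' → F ≋₂ F' → L φ F ≋₂ L φ F'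
  L-cong φ []      F'        e = ≋-sym (L-[] φ F' (≋-sym e))
  L-cong φ (f ∷ F) []        e = L-[] φ (f ∷ F) e
  L-cong φ (f ∷ F) (f' ∷ F') e = +P-cong (*P-congˡ (const (φ 0)) (liftZ-cong {f} {f'} (mk (at₂ e 0))))
    (*P-congˡ w (L-cong (λ m → φ (suc m)) F F' (∷-tail e)))

  L-0 : ∀ φ F → (∀ m → φ m ZX.≈P []) → L φ F ≋₂ []
  L-0 φ []      z = ≋-refl
  L-0 φ (f ∷ F) z = ≋-trans
    (+P-cong (*P-congʳ (liftZ f) (≋-trans (const-cong {φ 0} {[]} (z 0)) 0∷0)) (*P-congˡ w (L-0 (λ m → φ (suc m)) F (λ m → z (suc m)))))
    (*P-zeroʳ w)

  L-+ : ∀ φ F F' → L φ (F +P F') ≋₂ L φ F +P L φ F'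
  L-+ φ []      F'        = ≋-refl
  L-+ φ (f ∷ F) []        = ≋-sym (+P-identityʳ _)
  L-+ φ (f ∷ F) (f' ∷ F') = ≋-trans
    (+P-cong (*P-congˡ (const (φ 0)) (liftZ-+ f f')) (*P-congˡ w (L-+ (λ m → φ (suc m)) F F')))
    (solve 6 (λ c a b w d e → c :* (a :+ b) :+ w :* (d :+ e) := (c :* a :+ w :* d) :+ (c :* b :+ w :* e)) ≋-refl
      (const (φ 0)) (liftZ f) (liftZ f') w (L (λ m → φ (suc m)) F) (L (λ m → φ (suc m)) F'))

  L-φ- : ∀ φ ψ F → L (λ m → φ m ZX.+P (ZX.-P (ψ m))) F ≋₂ L φ F +P (-P (L ψ F))
  L-φ- φ ψ []      = ≋-refl
  L-φ- φ ψ (f ∷ F) = ≋-trans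
    (+P-congˡ ((const (φ 0) +P (-P (const (ψ 0)))) *P liftZ f) (*P-congˡ w (L-φ- (λ m → φ (suc m)) (λ m → ψ (suc m)) F)))
    (solve 6 (λ a b f w c d → (a :- b) :* f :+ w :* (c :- d) := (a :* f :+ w :* c) :- (b :* f :+ w :* d)) ≋-refl
      (const (φ 0)) (const (ψ 0)) (liftZ f) w (L (λ m → φ (suc m)) F) (L (λ m → ψ (suc m)) F))

  L-scale : ∀ φ g F → L φ (scale g F) ≋₂ liftZ g *P L φ F
  L-scale φ g []      = ≋-sym (*P-zeroʳ (liftZ g))
  L-scale φ g (f ∷ F) = ≋-trans
    (+P-cong (*P-congˡ (const (φ 0)) (liftZ-* g f)) (*P-congˡ w (L-scale (λ m → φ (suc m)) g F)))
    (solve 5 (λ c g f w l → c :* (g :* f) :+ w :* (g :* l) := g :* (c :* f :+ w :* l)) ≋-refl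
      (const (φ 0)) (liftZ g) (liftZ f) w (L (λ m → φ (suc m)) F))

  L-0∷ : ∀ φ F → L φ ([] ∷ F) ≋₂ w *P L (λ m → φ (suc m)) F
  L-0∷ φ F = +P-congʳ (w *P L (λ m → φ (suc m)) F) (*P-zeroʳ (const (φ 0)))

  L-X^ : ∀ N φ F → L φ ((X ^P N) *P F) ≋₂ (w ^P N) *P L (λ m → φ (N ℕ.+ m)) F
  L-X^ zero    φ F = ≋-trans (L-cong φ (1P *P F) F (CommutativeRing.*-identityˡ ring≋ F)) (≋-sym (CommutativeRing.*-identityˡ ring≋ (L φ F)))
  L-X^ (suc N) φ F = begin
    L φ ((X ^P suc N) *P F)                                ≈⟨ L-cong φ _ _ (≋-trans (*P-assoc X (X ^P N) F) (X-* ((X ^P N) *P F))) ⟩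
    L φ ([] ∷ ((X ^P N) *P F))                             ≈⟨ L-0∷ φ ((X ^P N) *P F) ⟩
    w *P L (λ m → φ (suc m)) ((X ^P N) *P F)               ≈⟨ *P-congˡ w (L-X^ N (λ m → φ (suc m)) F) ⟩
    w *P ((w ^P N) *P L (λ m → φ (suc N ℕ.+ m)) F)         ≈⟨ *P-assoc w (w ^P N) _ ⟨
    (w ^P suc N) *P L (λ m → φ (suc N ℕ.+ m)) F            ∎
    where open ≋-Reasoning

  -- Either a factor 1 + w^N is gained, or φ is replaced by a difference of φ.
  L-ψ : ∀ N φ F → L φ ((1P +P (X ^P N)) *P F) ≋₂
    ((1P +P (w ^P N)) *P L (λ m → φ (N ℕ.+ m)) F) +P (-P (L (λ m → φ (N ℕ.+ m) ZX.+P (ZX.-P (φ m))) F))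
  L-ψ N φ F = begin
    L φ ((1P +P (X ^P N)) *P F)
      ≈⟨ L-cong φ _ _ (solve 2 (λ y f → (con (+ 1) :+ y) :* f := f :+ y :* f) ≋-refl (X ^P N) F) ⟩
    L φ (F +P ((X ^P N) *P F))
      ≈⟨ L-+ φ F ((X ^P N) *P F) ⟩
    L φ F +P L φ ((X ^P N) *P F)
      ≈⟨ +P-congˡ (L φ F) (L-X^ N φ F) ⟩
    L φ F +P ((w ^P N) *P S)
      ≈⟨ solve 3 (λ l w s → l :+ w :* s := (con (+ 1) :+ w) :* s :- (s :- l)) ≋-refl (L φ F) (w ^P N) S ⟩
    ((1P +P (w ^P N)) *P S) +P (-P (S +P (-P (L φ F))))
      ≈⟨ +P-congˡ ((1P +P (w ^P N)) *P S) (-P-cong (L-φ- (λ m → φ (N ℕ.+ m)) φ F)) ⟨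
    ((1P +P (w ^P N)) *P S) +P (-P (L (λ m → φ (N ℕ.+ m) ZX.+P (ZX.-P (φ m))) F)) ∎
    where
    open ≋-Reasoning
    S = L (λ m → φ (N ℕ.+ m)) F

  L-applyUpTo : ∀ n φ (f : ℕ → ZX.Poly) → L φ (applyUpTo f (suc n)) ≋₂ sumTo n (λ m → (w ^P m) *P (const (φ m) *P liftZ (f m)))
  L-applyUpTo zero    φ f = ≋-trans (+P-congˡ (const (φ 0) *P liftZ (f 0)) (*P-zeroʳ w))
    (≋-trans (+P-identityʳ _) (≋-sym (CommutativeRing.*-identityˡ ring≋ _)))
  L-applyUpTo (suc n) φ f = begin
    (const (φ 0) *P liftZ (f 0)) +P (w *P L (λ m → φ (suc m)) (applyUpTo (λ m → f (suc m)) (suc n)))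
      ≈⟨ +P-cong (≋-sym (CommutativeRing.*-identityˡ ring≋ _)) (*P-congˡ w (L-applyUpTo n (λ m → φ (suc m)) (λ m → f (suc m)))) ⟩
    T 0 +P (w *P sumTo n (λ m → (w ^P m) *P (const (φ (suc m)) *P liftZ (f (suc m)))))
      ≈⟨ +P-congˡ (T 0) (*P-sumTo w n _) ⟩
    T 0 +P sumTo n (λ m → w *P ((w ^P m) *P (const (φ (suc m)) *P liftZ (f (suc m)))))
      ≈⟨ +P-congˡ (T 0) (sumTo-cong n (λ m → *P-assoc w (w ^P m) (const (φ (suc m)) *P liftZ (f (suc m))))) ⟨
    T 0 +P sumTo n (λ m → T (suc m))
      ≈⟨ sumTo-suc n T ⟨
    sumTo (suc n) T ∎
    where
    open ≋-Reasoning
    T : ℕ → Poly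
    T m = (w ^P m) *P (const (φ m) *P liftZ (f m))

-- Differentiation in q and the budget of a generating function.

D : Poly → Poly
D = map ZX.deriv

coeff-D : ∀ F i → coeff (D F) i ≡ ZX.deriv (coeff F i)
coeff-D []      i       = refl
coeff-D (f ∷ F) zero    = refl
coeff-D (f ∷ F) (suc i) = coeff-D F i

D-cong : ∀ {F F'} → F ≋₂ F' → D F ≋₂ D F'
D-cong {F} {F'} e = mk₂ λ i → at (𝕊.≋-trans (𝕊.≡⇒≋ (coeff-D F i))
  (𝕊.≋-trans (𝕊.deriv-cong {coeff F i} {coeff F' i} (mk (at₂ e i))) (𝕊.≡⇒≋ (≡.sym (coeff-D F' i)))))

D-+ : ∀ F F' → D (F +P F') ≋₂ D F +P D F'
D-+ []      F'        = ≋-refl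
D-+ (f ∷ F) []        = ≋-refl
D-+ (f ∷ F) (f' ∷ F') = ∷-cong (at (𝕊.deriv-+ f f')) (D-+ F F')

D-scale : ∀ g F → D (scale g F) ≋₂ scale (ZX.deriv g) F +P scale g (D F)
D-scale g []      = ≋-refl
D-scale g (f ∷ F) = ∷-cong (at (𝕊.deriv-* g f)) (D-scale g F)

D-X^ : ∀ N F → D ((X ^P N) *P F) ≋₂ (X ^P N) *P D F
D-X^ zero    F = ≋-trans (D-cong (CommutativeRing.*-identityˡ ring≋ F)) (≋-sym (CommutativeRing.*-identityˡ ring≋ (D F)))
D-X^ (suc N) F = begin
  D ((X ^P suc N) *P F)        ≈⟨ D-cong (shifted F) ⟩
  [] ∷ D ((X ^P N) *P F)       ≈⟨ ∷-cong (at (𝕊.≋-refl {[]})) (D-X^ N F) ⟩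
  [] ∷ ((X ^P N) *P D F)       ≈⟨ shifted (D F) ⟨
  (X ^P suc N) *P D F          ∎
  where
  open ≋-Reasoning
  shifted : ∀ F → (X ^P suc N) *P F ≋₂ [] ∷ ((X ^P N) *P F)
  shifted F = ≋-trans (*P-assoc X (X ^P N) F) (X-* ((X ^P N) *P F))

-- 1 + x^N is constant in q, so differentiation costs none of these factors; only factors Φ are
-- lost.
D-ψ : ∀ N F → D ((1P +P (X ^P N)) *P F) ≋₂ (1P +P (X ^P N)) *P D F
D-ψ N F = begin
  D ((1P +P (X ^P N)) *P F)        ≈⟨ D-cong (expand F) ⟩
  D (F +P ((X ^P N) *P F))         ≈⟨ D-+ F ((X ^P N) *P F) ⟩
  D F +P D ((X ^P N) *P F)         ≈⟨ +P-congˡ (D F) (D-X^ N F) ⟩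
  D F +P ((X ^P N) *P D F)         ≈⟨ expand (D F) ⟨
  (1P +P (X ^P N)) *P D F          ∎
  where
  open ≋-Reasoning
  expand : ∀ F → (1P +P (X ^P N)) *P F ≋₂ F +P ((X ^P N) *P F)
  expand F = solve 2 (λ y f → (con (+ 1) :+ y) :* f := f :+ y :* f) ≋-refl (X ^P N) F

-- The budget b of F bounds the degree p of φ, the number l of q-derivatives and the order e of
-- divisibility by p + 2l + 2e ≤ b; a factor 1 + x^N raises it by 1 and a factor Φ by 2.
module Budget (w : Poly) (N : ℕ) (Φ₀ : ZX.Poly) (I : ℕ → Poly → Set)
    (I-cong : ∀ {e F F'} → F ≋₂ F' → I e F → I e F')
    (I-0 : ∀ e → I e 0P)
    (I-all : ∀ F → I 0 F)
    (I-+ : ∀ {e F F'} → I e F → I e F' → I e (F +P F'))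
    (I-* : ∀ {e F} g → I e F → I e (g *P F))
    (I-Φ : ∀ {e F} → I e F → I (suc e) (liftZ Φ₀ *P F))
    (I-ψ : ∀ {e F} → I e F → I (suc e) ((1P +P (w ^P N)) *P F)) where
  open Functional w

  record V (b : ℕ) (F : Poly) : Set where
    constructor mkV
    field runV : ∀ p e φ → Deg< p φ → p ℕ.+ (e ℕ.+ e) ℕ.≤ b → I e (L φ F)
  open V

  -- For e = 0 the ideal is everything; for e ≥ 1 a budget of at most 2 forces p = 0, so φ = 0.
  V-2 : ∀ {b F} → b ℕ.≤ 2 → V b F
  V-2 {b} {F} b≤2 = mkV λ
    { p       zero    φ d le → I-all (L φ F)
    ; zero    (suc e) φ d le → I-cong (≋-sym (L-0 φ F d)) (I-0 (suc e))
    ; (suc p) (suc e) φ d le → absurd (ℕₚ.≤-trans (ℕₚ.≤-trans (ℕₚ.+-mono-≤ (s≤s z≤n) (two e)) le) b≤2) }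
    where
    absurd : ∀ {A : Set} → 3 ℕ.≤ 2 → A
    absurd (s≤s (s≤s ()))
    two : ∀ e → 2 ℕ.≤ suc e ℕ.+ suc e
    two e = ℕₚ.+-mono-≤ {1} {suc e} {1} (s≤s z≤n) (s≤s z≤n)

  V-mono : ∀ {b c F} → b ℕ.≤ c → V c F → V b F
  V-mono b≤c v = mkV λ p e φ d le → runV v p e φ d (ℕₚ.≤-trans le b≤c)

  V-cong : ∀ {b F F'} → F ≋₂ F' → V b F → V b F'
  V-cong {b} {F} {F'} eq v = mkV λ p e φ d le → I-cong (L-cong φ F F' eq) (runV v p e φ d le)

  V-+ : ∀ {b F F'} → V b F → V b F' → V b (F +P F')
  V-+ {b} {F} {F'} v v' = mkV λ p e φ d le → I-cong (≋-sym (L-+ φ F F')) (I-+ (runV v p e φ d le) (runV v' p e φ d le))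

  V-scale : ∀ {b F} g → V b F → V b (scale g F)
  V-scale {b} {F} g v = mkV λ p e φ d le → I-cong (≋-sym (L-scale φ g F)) (I-* (liftZ g) (runV v p e φ d le))

  V-0∷ : ∀ {b F} → V b F → V b ([] ∷ F)
  V-0∷ {b} {F} v = mkV λ p e φ d le → I-cong (≋-sym (L-0∷ φ F)) (I-* w (runV v p e (λ m → φ (suc m)) (Deg<-shift p 1 d) le))

  private
    drop-e : ∀ p e {b} → p ℕ.+ (suc e ℕ.+ suc e) ℕ.≤ 2 ℕ.+ b → p ℕ.+ (e ℕ.+ e) ℕ.≤ b
    drop-e p e {b} le = ℕₚ.≤-pred (ℕₚ.≤-pred (≡.subst (ℕ._≤ 2 ℕ.+ b)
      (≡.trans (≡.cong (p ℕ.+_) (≡.cong suc (ℕₚ.+-suc e e))) (≡.trans (ℕₚ.+-suc p _) (≡.cong suc (ℕₚ.+-suc p _)))) le))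

  V-Φ : ∀ {b F} → V b F → V (2 ℕ.+ b) (scale Φ₀ F)
  V-Φ {b} {F} v = mkV λ
    { p zero    φ d le → I-all _
    ; p (suc e) φ d le → I-cong (≋-sym (L-scale φ Φ₀ F)) (I-Φ (runV v p e φ d (drop-e p e le))) }

  -- Of the two terms of `L-ψ`, the first gains 1 + w^N, so it needs only `e` powers from `F`,
  -- saving 2; the second keeps the exponent but has a difference of φ, saving 1. The smaller saving
  -- is what a factor 1 + x^N is worth.
  V-ψ : ∀ {b F} → V b F → V (suc b) ((1P +P (X ^P N)) *P F)
  V-ψ {b} {F} v = mkV λ
    { p       zero    φ d le → I-all _
    ; zero    (suc e) φ d le → I-cong (≋-sym (L-0 φ ((1P +P (X ^P N)) *P F) d)) (I-0 (suc e))
    ; (suc p) (suc e) φ d le → I-cong (≋-sym (L-ψ N φ F)) (I-+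
        (I-ψ (runV v (suc p) e (λ m → φ (N ℕ.+ m)) (Deg<-shift (suc p) {φ} N d) (drop-e (suc p) e (ℕₚ.m≤n⇒m≤1+n le))))
        (I-cong (solve 1 (λ a → (:- con (+ 1)) :* a := :- a) ≋-refl (L (λ m → φ (N ℕ.+ m) ZX.+P (ZX.-P (φ m))) F))
          (I-* (-P 1P) (runV v p (suc e) (λ m → φ (N ℕ.+ m) ZX.+P (ZX.-P (φ m))) (d N) (ℕₚ.≤-pred le))))) }

  -- Each differentiation may destroy one Φ, hence the loss of 2. Truncation at 0 is harmless, since
  -- budgets up to 2 hold for every element.
  W : ℕ → ℕ → Poly → Set
  W zero    b F = V b F
  W (suc l) b F = W l (b ℕ.∸ 2) (D F)

  W-2 : ∀ l {b F} → b ℕ.≤ 2 → W l b F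
  W-2 zero    b≤2 = V-2 b≤2
  W-2 (suc l) b≤2 = W-2 l (ℕₚ.≤-trans (ℕₚ.m∸n≤m _ 2) b≤2)

  W-mono : ∀ l {b c F} → b ℕ.≤ c → W l c F → W l b F
  W-mono zero    b≤c = V-mono b≤c
  W-mono (suc l) b≤c = W-mono l (ℕₚ.∸-monoˡ-≤ 2 b≤c)

  W-cong : ∀ l {b F F'} → F ≋₂ F' → W l b F → W l b F'
  W-cong zero    e = V-cong e
  W-cong (suc l) e = W-cong l (D-cong e)

  W-+ : ∀ l {b F F'} → W l b F → W l b F' → W l b (F +P F')
  W-+ zero    v v' = V-+ v v'
  W-+ (suc l) {b} {F} {F'} v v' = W-cong l (≋-sym (D-+ F F')) (W-+ l v v')

  W-0∷ : ∀ l {b F} → W l b F → W l b ([] ∷ F)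
  W-0∷ zero    = V-0∷
  W-0∷ (suc l) = W-0∷ l

  W-ψ : ∀ l {b F} → W l b F → W l (suc b) ((1P +P (X ^P N)) *P F)
  W-ψ zero    = V-ψ
  W-ψ (suc l) {b} {F} v = W-cong l (≋-sym (D-ψ N F)) (W-mono l (bound b) (W-ψ l v))
    where
    bound : ∀ b → suc b ℕ.∸ 2 ℕ.≤ suc (b ℕ.∸ 2)
    bound zero          = z≤n
    bound (suc zero)    = z≤n
    bound (suc (suc b)) = ℕₚ.≤-refl

  -- By the Leibniz rule, the derivatives of g F involve all lower derivatives of `F`. Quantifying
  -- over every order `l` therefore makes the predicate an ideal, stable under `D` at the price of
  -- 2.
  record G (b : ℕ) (F : Poly) : Set where
    constructor mkG
    field runG : ∀ l → W l b F
  open G public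

  G-D : ∀ {b F} → G b F → G (b ℕ.∸ 2) (D F)
  G-D g = mkG λ l → runG g (suc l)

  G-mono : ∀ {b c F} → b ℕ.≤ c → G c F → G b F
  G-mono b≤c g = mkG λ l → W-mono l b≤c (runG g l)

  G-2 : ∀ F → G 2 F
  G-2 F = mkG λ l → W-2 l ℕₚ.≤-refl

  G-cong : ∀ {b F F'} → F ≋₂ F' → G b F → G b F'
  G-cong e g = mkG λ l → W-cong l e (runG g l)

  G-+ : ∀ {b F F'} → G b F → G b F' → G b (F +P F')
  G-+ g g' = mkG λ l → W-+ l (runG g l) (runG g' l)

  W-scale : ∀ l g {b F} → G b F → W l b (scale g F)
  W-scale zero    g γ = V-scale g (runG γ 0)
  W-scale (suc l) g {b} {F} γ = W-cong l (≋-sym (D-scale g F))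
    (W-+ l (W-scale l (ZX.deriv g) (G-mono (ℕₚ.m∸n≤m b 2) γ)) (W-scale l g (G-D γ)))

  -- In D(Φ F) = Φ' F + Φ D F the first term has lost Φ but keeps the full budget `b` of `F`; in the
  -- second, `F` pays 2 and Φ gives it back. Both have at least `b`, which is 2 + b less the price
  -- of one derivative.
  W-Φ : ∀ l {b F} → G b F → W l (2 ℕ.+ b) (scale Φ₀ F)
  W-Φ zero    γ = V-Φ (runG γ 0)
  W-Φ (suc l) {b} {F} γ = W-cong l (≋-sym (D-scale Φ₀ F))
    (W-+ l (W-scale l (ZX.deriv Φ₀) γ) (W-mono l (ℕₚ.m≤n+m∸n b 2) (W-Φ l (G-D γ))))

  G-[] : ∀ b → G b []
  G-[] b = mkG (λ l → zero-W l b)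
    where
    zero-W : ∀ l b → W l b []
    zero-W zero    b = mkV λ p e φ d le → I-0 e
    zero-W (suc l) b = zero-W l (b ℕ.∸ 2)

  G-* : ∀ {b F} Y → G b F → G b (Y *P F)
  G-* {b} []      γ = G-[] b
  G-* {b} (y ∷ Y) γ = G-+ (mkG λ l → W-scale l y γ) (mkG λ l → W-0∷ l (runG (G-* Y γ) l))

  G-Φ : ∀ {b F} → G b F → G (2 ℕ.+ b) (const Φ₀ *P F)
  G-Φ {b} {F} γ = G-cong (≋-sym (const-* Φ₀ F)) (mkG λ l → W-Φ l γ)

  G-ψ : ∀ {b F} → G b F → G (suc b) ((1P +P (X ^P N)) *P F)
  G-ψ γ = mkG λ l → W-ψ l (runG γ l)

  W-derivN : ∀ l {b F} → W l (l ℕ.+ l ℕ.+ b) F → V b (map (ZX.derivN l) F)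
  W-derivN zero    {b} {F} v = ≡.subst (V b) (≡.sym (Listₚ.map-id F)) v
  W-derivN (suc l) {b} {F} v = ≡.subst (V b) map-derivN
    (W-derivN l (≡.subst (λ n → W l n (D F)) (≡.cong (λ n → n ℕ.+ b ℕ.∸ 1) (ℕₚ.+-suc l l)) v))
    where
    derivN-deriv : ∀ l p → ZX.derivN l (ZX.deriv p) ≡ ZX.derivN (suc l) p
    derivN-deriv zero    p = refl
    derivN-deriv (suc l) p = ≡.cong ZX.deriv (derivN-deriv l p)
    map-derivN : map (ZX.derivN l) (D F) ≡ map (ZX.derivN (suc l)) F
    map-derivN = ≡.trans (≡.sym (Listₚ.map-∘ F)) (Listₚ.map-cong (derivN-deriv l) F)

  G-bound : ∀ {b F} → G b F → ∀ l p e φ → Deg< p φ → p ℕ.+ ((l ℕ.+ l) ℕ.+ (e ℕ.+ e)) ℕ.≤ b → I e (L φ (map (ZX.derivN l) F))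
  G-bound {b} γ l p e φ d le = runV (W-derivN l {p ℕ.+ (e ℕ.+ e)}
      (W-mono l (≡.subst (ℕ._≤ b) eq le) (runG γ l))) p e φ d ℕₚ.≤-refl
    where
    eq : p ℕ.+ ((l ℕ.+ l) ℕ.+ (e ℕ.+ e)) ≡ l ℕ.+ l ℕ.+ (p ℕ.+ (e ℕ.+ e))
    eq = ≡.trans (≡.sym (ℕₚ.+-assoc p (l ℕ.+ l) (e ℕ.+ e)))
      (≡.trans (≡.cong (ℕ._+ (e ℕ.+ e)) (ℕₚ.+-comm p (l ℕ.+ l))) (ℕₚ.+-assoc (l ℕ.+ l) p (e ℕ.+ e)))

open import Data.Nat using (_*_; _+_; _≤_; _<_; _%_)

-- Divisibility by `Φ` and the Rogers-Szegő polynomials.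

coeff-+≋ : ∀ F F' m → coeff (F +P F') m ≋ coeff F m ZX.+P coeff F' m
coeff-+≋ F F' m = mk (coeff-+ F F' m)

coeff-neg≋ : ∀ F m → coeff (-P F) m ≋ ZX.-P (coeff F m)
coeff-neg≋ F m = mk (coeff-neg F m)

coeff-scale≋ : ∀ g F m → coeff (scale g F) m ≋ g ZX.*P coeff F m
coeff-scale≋ g F m = mk (coeff-scale g F m)

const-cong≋ : ∀ {p q} → p ≋ q → const p ≋₂ const q
const-cong≋ {p} {q} e = const-cong {p} {q} (at e)

Φ-∣-xN-1 : ∀ {N} → 0 < N → ∀ a → Φ N ∣P xN-1 (a * N)
Φ-∣-xN-1 {N} 0<N a = 𝕊.∣P-trans (Φ-∣ (cyclotomic N 0<N)) (xN-1-∣ {N} {a * N} (n∣m*n a))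

-- Induction by 1 + y² p = y² (1 + p) + (1 + y)(1 - y).
1+y-∣-1+y^odd : ∀ y j → (ZX.1P ZX.+P y) ∣P (ZX.1P ZX.+P (y ZX.^P (1 + j * 2)))
1+y-∣-1+y^odd y zero    = dividesP ZX.1P
  (𝕊S.solve 1 (λ y → 𝕊S.con (+ 1) 𝕊S.:+ y 𝕊S.:* 𝕊S.con (+ 1) 𝕊S.:= (𝕊S.con (+ 1) 𝕊S.:+ y) 𝕊S.:* 𝕊S.con (+ 1)) 𝕊.≋-refl y)
1+y-∣-1+y^odd y (suc j) = 𝕊.∣P-cong
  (𝕊S.solve 2 (λ y p → (y 𝕊S.:* y) 𝕊S.:* (𝕊S.con (+ 1) 𝕊S.:+ p) 𝕊S.:+ (𝕊S.con (+ 1) 𝕊S.:+ y) 𝕊S.:* (𝕊S.con (+ 1) 𝕊S.:- y)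
      𝕊S.:= 𝕊S.con (+ 1) 𝕊S.:+ y 𝕊S.:* (y 𝕊S.:* p)) 𝕊.≋-refl y (y ZX.^P (1 + j * 2)))
  (𝕊.∣P-+ (𝕊.∣P-*ˡ (y ZX.*P y) (1+y-∣-1+y^odd y j)) (𝕊.∣P-*ʳ (ZX.1P ZX.+P (ZX.-P y)) 𝕊.∣P-refl))

-- This is ζ^{kc} = -1 as a divisibility: 1 + x^c is the geometric sum (x^{2c} - 1)/(x^c - 1), hence
-- a multiple of Φ_{2c}, and it divides 1 + x^{kc} because `k` is odd.
Φ-∣-1+X^ : ∀ {c k} → 0 < c → k % 2 ≡ 1 → Φ (2 * c) ∣P (ZX.1P ZX.+P (ZX.X ZX.^P (k * c)))
Φ-∣-1+X^ {c} {k} 0<c odd = 𝕊.∣P-cong (𝕊.+P-congˡ ZX.1P power)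
  (𝕊.∣P-trans (𝕊.∣P-cong two (geometric (cyclotomic (2 * c) 0<2c) c 2 (ℕₚ.*-comm c 2) (s≤s (s≤s z≤n)))) (1+y-∣-1+y^odd (ZX.X ZX.^P c) (k / 2)))
  where
  0<2c : 0 < 2 * c
  0<2c = ℕₚ.≤-trans 0<c (ℕₚ.m≤m+n c _)
  two : geo (ZX.X ZX.^P c) 2 ≋ ZX.1P ZX.+P (ZX.X ZX.^P c)
  two = 𝕊S.solve 1 (λ y → 𝕊S.con (+ 1) 𝕊S.:+ y 𝕊S.:* (𝕊S.con (+ 1) 𝕊S.:+ y 𝕊S.:* 𝕊S.con (+ 0)) 𝕊S.:= 𝕊S.con (+ 1) 𝕊S.:+ y) 𝕊.≋-refl (ZX.X ZX.^P c)
  k≡ : 1 + k / 2 * 2 ≡ k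
  k≡ = ≡.sym (≡.trans (m≡m%n+[m/n]*n k 2) (≡.cong (_+ k / 2 * 2) odd))
  power : (ZX.X ZX.^P c) ZX.^P (1 + k / 2 * 2) ≋ ZX.X ZX.^P (k * c)
  power = 𝕊.≋-trans (𝕊.≡⇒≋ (≡.cong ((ZX.X ZX.^P c) ZX.^P_) k≡))
    (𝕊.≋-trans (𝕊.≋-sym (𝕊.^P-* ZX.X c k)) (𝕊.≡⇒≋ (≡.cong (ZX.X ZX.^P_) (ℕₚ.*-comm c k))))

∣-qbinom : ∀ {A} n m → A ∣P xN-1 (suc n) → Cancels A (xN-1 (suc m)) → A ∣P ZX.qbinom (suc n) (suc m)
∣-qbinom {A} n m A∣ cancels = cancels B (𝕊.∣P-cong rearrange (𝕊.∣P-*ʳ (ZX.qbinom n m) A∣))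
  where
  open 𝕊.≋-Reasoning
  B = ZX.qbinom (suc n) (suc m)
  xn = ZX.X ZX.^P suc n
  xm = ZX.X ZX.^P suc m
  rearrange : xN-1 (suc n) ZX.*P ZX.qbinom n m ≋ B ZX.*P xN-1 (suc m)
  rearrange = begin
    xN-1 (suc n) ZX.*P ZX.qbinom n m
      ≈⟨ 𝕊S.solve 2 (λ x b → (x 𝕊S.:- 𝕊S.con (+ 1)) 𝕊S.:* b 𝕊S.:= 𝕊S.:- ((𝕊S.con (+ 1) 𝕊S.:- x) 𝕊S.:* b)) 𝕊.≋-refl xn (ZX.qbinom n m) ⟩
    ZX.-P (1-X^ (suc n) ZX.*P ZX.qbinom n m)
      ≈⟨ 𝕊.-P-cong (qbinom-absorb n m) ⟨
    ZX.-P (1-X^ (suc m) ZX.*P B)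
      ≈⟨ 𝕊S.solve 2 (λ x b → b 𝕊S.:* (x 𝕊S.:- 𝕊S.con (+ 1)) 𝕊S.:= 𝕊S.:- ((𝕊S.con (+ 1) 𝕊S.:- x) 𝕊S.:* b)) 𝕊.≋-refl xm B ⟨
    B ZX.*P xN-1 (suc m) ∎

Φ-∣-qbinom : ∀ {N m} → 0 < m → m < N → Φ N ∣P ZX.qbinom N m
Φ-∣-qbinom {suc n} {suc m} 0<m m<N = ∣-qbinom n m (Φ-∣ cyc) (Φ-cancels cyc (s≤s z≤n) (λ N∣m → ℕₚ.<⇒≱ m<N (∣⇒≤ N∣m)))
  where cyc = cyclotomic (suc n) (s≤s z≤n)

rogersSzegő : ℕ → Poly
rogersSzegő n = applyUpTo (ZX.qbinom n) (suc n)

coeff-rogersSzegő : ∀ n m → coeff (rogersSzegő n) m ≋ ZX.qbinom n m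
coeff-rogersSzegő n m = mk (coeff-applyUpTo (ZX.qbinom n) (suc n) (λ i n<i → at (qbinom-> n i n<i)) m)

rogersSzegő-1 : rogersSzegő 1 ≋₂ 1P +P X
rogersSzegő-1 = mk₂ λ
  { zero          → at (𝕊.≋-refl {ZX.1P})
  ; (suc zero)    → at (qbinom-diag 1)
  ; (suc (suc i)) → at (𝕊.≋-refl {[]}) }

rogersSzegő-recurrence : ∀ n → rogersSzegő (suc (suc n)) ≋₂
  ((1P +P X) *P rogersSzegő (suc n)) +P (-P (X *P (const (1-X^ (suc n)) *P rogersSzegő n)))
rogersSzegő-recurrence n = ≋-sym (begin
  ((1P +P X) *P h₁) +P (-P (X *P (const v *P h₀)))
    ≈⟨ +P-congʳ (-P (X *P (const v *P h₀))) (solve 2 (λ x a → (con (+ 1) :+ x) :* a := a :+ x :* a) ≋-refl X h₁) ⟩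
  (h₁ +P (X *P h₁)) +P (-P (X *P (const v *P h₀)))
    ≈⟨ +P-cong (+P-congˡ h₁ (X-* h₁)) (-P-cong (≋-trans (*P-congˡ X (const-* v h₀)) (X-* (scale v h₀)))) ⟩
  (h₁ +P ([] ∷ h₁)) +P (-P ([] ∷ scale v h₀))
    ≈⟨ mk₂ (λ m → at (coefficient m)) ⟩
  rogersSzegő (suc (suc n)) ∎)
  where
  open ≋-Reasoning
  v = 1-X^ (suc n)
  h₀ = rogersSzegő n
  h₁ = rogersSzegő (suc n)
  coefficient : ∀ m → coeff ((h₁ +P ([] ∷ h₁)) +P (-P ([] ∷ scale v h₀))) m ≋ coeff (rogersSzegő (suc (suc n))) m
  coefficient zero    = 𝕊.≋-refl
  coefficient (suc m) = 𝕊.≋-trans (coeff-+≋ (h₁ +P ([] ∷ h₁)) (-P ([] ∷ scale v h₀)) (suc m))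
    (𝕊.≋-trans (𝕊.+P-cong
        (𝕊.≋-trans (coeff-+≋ h₁ ([] ∷ h₁) (suc m)) (𝕊.+P-cong (coeff-rogersSzegő (suc n) (suc m)) (coeff-rogersSzegő (suc n) m)))
        (𝕊.≋-trans (coeff-neg≋ (scale v h₀) m)
          (𝕊.-P-cong (𝕊.≋-trans (coeff-scale≋ v h₀ m) (𝕊.*P-congˡ v (coeff-rogersSzegő n m))))))
      (𝕊.≋-trans (𝕊.≋-sym (qbinom-recurrence n m)) (𝕊.≋-sym (coeff-rogersSzegő (suc (suc n)) (suc m)))))

const-∣ : ∀ g F → (∀ m → g ∣P coeff F m) → ∃ λ γ → F ≋₂ const g *P γ
const-∣ g F div = let (γ , e) = scaled F div in γ , ≋-trans e (≋-sym (const-* g γ))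
  where
  scaled : ∀ F → (∀ m → g ∣P coeff F m) → ∃ λ γ → F ≋₂ scale g γ
  scaled []      div = [] , ≋-refl
  scaled (f ∷ F) div with div 0 | scaled F (λ m → div (suc m))
  ... | dividesP s e | γ , e' = s ∷ γ , ∷-cong (at e) e'

rogersSzegő-N : ∀ {N} → 0 < N → ∃ λ γ → rogersSzegő N ≋₂ (1P +P (X ^P N)) +P (const (Φ N) *P γ)
rogersSzegő-N {N} 0<N with const-∣ (Φ N) (rogersSzegő N +P (-P (1P +P (X ^P N)))) (λ m → 𝕊.∣P-cong (𝕊.≋-sym (coefficient m)) (Φ∣ m))
  where
  E : ℕ → ZX.Poly
  E m = ZX.qbinom N m ZX.+P (ZX.-P (coeff 1P m ZX.+P coeff (X ^P N) m))
  coefficient : ∀ m → coeff (rogersSzegő N +P (-P (1P +P (X ^P N)))) m ≋ E m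
  coefficient m = 𝕊.≋-trans (coeff-+≋ (rogersSzegő N) (-P (1P +P (X ^P N))) m)
    (𝕊.+P-cong (coeff-rogersSzegő N m) (𝕊.≋-trans (coeff-neg≋ (1P +P (X ^P N)) m) (𝕊.-P-cong (coeff-+≋ 1P (X ^P N) m))))
  vanish : ∀ a b c x y z → a ≋ x → b ≋ y → c ≋ z → x ZX.+P (ZX.-P (y ZX.+P z)) ≋ [] → Φ N ∣P (a ZX.+P (ZX.-P (b ZX.+P c)))
  vanish a b c x y z ea eb ec e = dividesP [] (𝕊.≋-trans (𝕊.+P-cong ea (𝕊.-P-cong (𝕊.+P-cong eb ec))) (𝕊.≋-trans e (𝕊.≋-sym (𝕊.*P-zeroʳ (Φ N)))))
  Φ∣ : ∀ m → Φ N ∣P E m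
  Φ∣ zero = vanish (ZX.qbinom N 0) (coeff 1P 0) (coeff (X ^P N) 0) ZX.1P ZX.1P [] 𝕊.≋-refl 𝕊.≋-refl (mk (coeff-X^-off N 0 (ℕₚ.<⇒≢ 0<N))) (mk λ { zero → refl ; (suc i) → refl })
  Φ∣ (suc m) with ℕₚ.<-cmp (suc m) N
  ... | tri< lt ne _ = 𝕊.∣P-cong (𝕊.≋-sym (𝕊.≋-trans (𝕊.+P-congˡ B (𝕊.-P-cong {coeff (X ^P N) (suc m)} {[]} (mk (coeff-X^-off N (suc m) ne)))) (𝕊.+P-identityʳ B)))
                         (Φ-∣-qbinom (s≤s z≤n) lt)
    where B = ZX.qbinom N (suc m)
  ... | tri≈ _ e _ = vanish (ZX.qbinom N (suc m)) [] (coeff (X ^P N) (suc m)) ZX.1P [] ZX.1P (𝕊.≋-trans (𝕊.≡⇒≋ (≡.cong (ZX.qbinom N) e)) (qbinom-diag N)) 𝕊.≋-refl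
                         (𝕊.≋-trans (𝕊.≡⇒≋ (≡.cong (coeff (X ^P N)) e)) (mk (coeff-X^-diag N))) (mk λ { zero → refl ; (suc i) → refl })
  ... | tri> _ ne gt = vanish (ZX.qbinom N (suc m)) [] (coeff (X ^P N) (suc m)) [] [] [] (qbinom-> N (suc m) gt) 𝕊.≋-refl (mk (coeff-X^-off N (suc m) ne)) 𝕊.≋-refl
... | γ , e = γ , ≋-trans (solve 2 (λ h p → h := p :+ (h :- p)) ≋-refl (rogersSzegő N) (1P +P (X ^P N))) (+P-congˡ (1P +P (X ^P N)) e)

1-X^-periodic : ∀ {N} → 0 < N → ∀ a r → ∃ λ s → const (1-X^ (r + a * N)) ≋₂ const (1-X^ r) +P (const (Φ N) *P s)
1-X^-periodic {N} 0<N a r = const t , ≋-trans (const-cong≋ level1) (+P-congˡ (const (1-X^ r)) (const-*P (Φ N) t))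
  where
  open _∣P_ (Φ-∣-xN-1 0<N a) renaming (quotient to s; equality to e)
  open 𝕊.≋-Reasoning
  xr = ZX.X ZX.^P r
  xa = ZX.X ZX.^P (a * N)
  t = (ZX.-P xr) ZX.*P s
  level1 : 1-X^ (r + a * N) ≋ 1-X^ r ZX.+P (Φ N ZX.*P t)
  level1 = begin
    1-X^ (r + a * N)
      ≈⟨ 𝕊.+P-congˡ ZX.1P (𝕊.-P-cong (𝕊.^P-+ ZX.X r (a * N))) ⟩
    ZX.1P ZX.+P (ZX.-P (xr ZX.*P xa))
      ≈⟨ 𝕊S.solve 2 (λ x y → 𝕊S.con (+ 1) 𝕊S.:- x 𝕊S.:* y 𝕊S.:= (𝕊S.con (+ 1) 𝕊S.:- x) 𝕊S.:+ (𝕊S.:- x) 𝕊S.:* (y 𝕊S.:- 𝕊S.con (+ 1))) 𝕊.≋-refl xr xa ⟩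
    1-X^ r ZX.+P ((ZX.-P xr) ZX.*P xN-1 (a * N))
      ≈⟨ 𝕊.+P-congˡ (1-X^ r) (𝕊.*P-congˡ (ZX.-P xr) e) ⟩
    1-X^ r ZX.+P ((ZX.-P xr) ZX.*P (Φ N ZX.*P s))
      ≈⟨ 𝕊.+P-congˡ (1-X^ r) (𝕊S.solve 3 (λ x f s → (𝕊S.:- x) 𝕊S.:* (f 𝕊S.:* s) 𝕊S.:= f 𝕊S.:* ((𝕊S.:- x) 𝕊S.:* s)) 𝕊.≋-refl xr (Φ N) s) ⟩
    1-X^ r ZX.+P (Φ N ZX.*P t) ∎

-- Specialisation to x = ζ q^z and the final estimate.

module CyclotomicIdeal (c k z : ℕ) (0<c : 0 < c) (0<k : 0 < k) (odd : k % 2 ≡ 1) where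
  N : ℕ
  N = k * c

  0<N : 0 < N
  0<N = ℕₚ.*-mono-≤ 0<k 0<c

  w : Poly
  w = const ZX.X *P (X ^P z)

  -- The ideal of ℤ[t][q] generated by Φ_N(q)^e and Φ_{2c}(t), that is, divisibility by Φ_N^e once t
  -- is read as ζ.
  record I (e : ℕ) (F : Poly) : Set where
    constructor mkI
    field
      q r : Poly
      eq  : F ≋₂ (liftZ (Φ N ZX.^P e) *P q) +P (const (Φ (2 * c)) *P r)

  I-cong : ∀ {e F F'} → F ≋₂ F' → I e F → I e F'
  I-cong h (mkI q r eq) = mkI q r (≋-trans (≋-sym h) eq)

  I-0 : ∀ e → I e 0P
  I-0 e = mkI 0P 0P (≋-sym (+P-cong (*P-zeroʳ (liftZ (Φ N ZX.^P e))) (*P-zeroʳ (const (Φ (2 * c))))))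

  I-all : ∀ F → I 0 F
  I-all F = mkI F 0P (≋-sym (≋-trans (+P-cong (CommutativeRing.*-identityˡ ring≋ F) (*P-zeroʳ (const (Φ (2 * c))))) (+P-identityʳ F)))

  I-+ : ∀ {e F F'} → I e F → I e F' → I e (F +P F')
  I-+ {e} (mkI q r eq) (mkI q' r' eq') = mkI (q +P q') (r +P r') (≋-trans (+P-cong eq eq')
    (solve 6 (λ g q q' f r r' → (g :* q :+ f :* r) :+ (g :* q' :+ f :* r') := g :* (q :+ q') :+ f :* (r :+ r')) ≋-refl
      (liftZ (Φ N ZX.^P e)) q q' (const (Φ (2 * c))) r r'))

  I-* : ∀ {e F} g → I e F → I e (g *P F)
  I-* {e} g (mkI q r eq) = mkI (g *P q) (g *P r) (≋-trans (*P-congˡ g eq)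
    (solve 5 (λ g a q f r → g :* (a :* q :+ f :* r) := a :* (g :* q) :+ f :* (g :* r)) ≋-refl
      g (liftZ (Φ N ZX.^P e)) q (const (Φ (2 * c))) r))

  -- The product of `I 1` and `I e` lies in `I (suc e)`: every term that contains Φ_{2c}(t) is
  -- absorbed by the second generator.
  I-1* : ∀ {e F y} s t → y ≋₂ (liftZ (Φ N) *P s) +P (const (Φ (2 * c)) *P t) → I e F → I (suc e) (y *P F)
  I-1* {e} {F} {y} s t ey (mkI q r eq) = mkI (s *P q) ((liftZ (Φ N) *P (s *P r)) +P (t *P F)) (begin
    y *P F
      ≈⟨ *P-congʳ F ey ⟩
    ((g *P s) +P (f *P t)) *P F
      ≈⟨ solve 5 (λ g s f t F → (g :* s :+ f :* t) :* F := (g :* s) :* F :+ f :* (t :* F)) ≋-refl g s f t F ⟩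
    ((g *P s) *P F) +P (f *P (t *P F))
      ≈⟨ +P-congʳ (f *P (t *P F)) (*P-congˡ (g *P s) eq) ⟩
    ((g *P s) *P ((ge *P q) +P (f *P r))) +P (f *P (t *P F))
      ≈⟨ solve 7 (λ g s h q f r u → (g :* s) :* (h :* q :+ f :* r) :+ f :* u := (g :* h) :* (s :* q) :+ f :* (g :* (s :* r) :+ u)) ≋-refl g s ge q f r (t *P F) ⟩
    ((g *P ge) *P (s *P q)) +P (f *P ((g *P (s *P r)) +P (t *P F)))
      ≈⟨ +P-congʳ (f *P ((g *P (s *P r)) +P (t *P F))) (*P-congʳ (s *P q) (liftZ-* (Φ N) (Φ N ZX.^P e))) ⟨
    (liftZ (Φ N ZX.^P suc e) *P (s *P q)) +P (f *P ((g *P (s *P r)) +P (t *P F))) ∎)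
    where
    open ≋-Reasoning
    g = liftZ (Φ N)
    ge = liftZ (Φ N ZX.^P e)
    f = const (Φ (2 * c))

  I-Φ : ∀ {e F} → I e F → I (suc e) (liftZ (Φ N) *P F)
  I-Φ = I-1* 1P 0P (≋-sym (≋-trans (+P-cong (CommutativeRing.*-identityʳ ring≋ (liftZ (Φ N))) (*P-zeroʳ (const (Φ (2 * c))))) (+P-identityʳ _)))

  const-^ : ∀ p n → const (p ZX.^P n) ≋₂ const p ^P n
  const-^ p zero    = ≋-refl
  const-^ p (suc n) = ≋-trans (const-*P p (p ZX.^P n)) (*P-congˡ (const p) (const-^ p n))

  w^ : ∀ m → w ^P m ≋₂ const (ZX.X ZX.^P m) *P (X ^P (z * m))
  w^ m = ≋-trans (^P-*-comm (const ZX.X) (X ^P z) m) (*P-cong (≋-sym (const-^ ZX.X m)) (≋-sym (^P-* X z m)))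

  -- 1 + t^N q^{zN} = t^N (q^{zN} - 1) + (1 + t^N): the first summand is a multiple of Φ_N(q), the
  -- second of Φ_{2c}(t).
  I-ψ : ∀ {e F} → I e F → I (suc e) ((1P +P (w ^P N)) *P F)
  I-ψ = I-1* (T *P liftZ s) (const r) (begin
    1P +P (w ^P N)
      ≈⟨ +P-congˡ 1P (≋-trans (w^ N) (*P-congˡ T lifted)) ⟩
    1P +P (T *P (1P +P (liftZ (Φ N) *P liftZ s)))
      ≈⟨ solve 3 (λ t g s → con (+ 1) :+ t :* (con (+ 1) :+ g :* s) := g :* (t :* s) :+ (con (+ 1) :+ t)) ≋-refl T (liftZ (Φ N)) (liftZ s) ⟩
    (liftZ (Φ N) *P (T *P liftZ s)) +P (1P +P T)
      ≈⟨ +P-congˡ (liftZ (Φ N) *P (T *P liftZ s)) (≋-trans (const-cong≋ e₁) (const-*P (Φ (2 * c)) r)) ⟩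
    (liftZ (Φ N) *P (T *P liftZ s)) +P (const (Φ (2 * c)) *P const r) ∎)
    where
    open ≋-Reasoning
    open _∣P_ (Φ-∣-1+X^ {c} {k} 0<c odd) renaming (quotient to r; equality to e₁)
    open _∣P_ (Φ-∣-xN-1 0<N z) renaming (quotient to s; equality to e₂)
    T = const (ZX.X ZX.^P N)
    level1 : ZX.X ZX.^P (z * N) ≋ ZX.1P ZX.+P (Φ N ZX.*P s)
    level1 = 𝕊.≋-trans (𝕊S.solve 1 (λ x → x 𝕊S.:= 𝕊S.con (+ 1) 𝕊S.:+ (x 𝕊S.:- 𝕊S.con (+ 1))) 𝕊.≋-refl (ZX.X ZX.^P (z * N)))
      (𝕊.+P-congˡ ZX.1P e₂)
    lifted : X ^P (z * N) ≋₂ 1P +P (liftZ (Φ N) *P liftZ s)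
    lifted = ≋-trans (≋-sym (liftZ-X^ (z * N))) (≋-trans (liftZ-cong level1)
      (≋-trans (liftZ-+ ZX.1P (Φ N ZX.*P s)) (+P-congˡ 1P (liftZ-* (Φ N) s))))

  open Budget w N (Φ N) I I-cong I-0 I-all I-+ I-* I-Φ I-ψ
  open Functional w
  open Ideals ring≋
  open ThreeTermRecurrence ring≋
  open Sequence rogersSzegő (λ n → const (1-X^ n)) X (const (Φ N))
    ≋-refl rogersSzegő-1 (≋-trans (const-cong≋ (𝕊.-P-inverseʳ ZX.1P)) 0∷0) rogersSzegő-recurrence

  G-ideal : ∀ b → IsIdeal (G b)
  G-ideal b = record { J-cong = G-cong ; J-0 = G-[] b ; J-+ = G-+ ; J-* = λ Y → G-* Y }

  G-rogersSzegő : ∀ a n → a * N ≤ n → G (2 + a) (rogersSzegő n)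
  G-rogersSzegő = Filtration.h-filtration N 0<N (1P +P (X ^P N)) (proj₁ (rogersSzegő-N 0<N)) (proj₂ (rogersSzegő-N 0<N))
    (1-X^-periodic 0<N) G G-ideal G-mono G-2 G-Φ G-ψ

  lhs-L : ∀ P l n → L (λ m → eval P (nat m)) (map (ZX.derivN l) (rogersSzegő n)) ≋₂ lhs P z l n
  lhs-L P l n = ≋-trans (≡⇒≋ (≡.cong (L φ) (Listₚ.map-applyUpTo (ZX.qbinom n) (ZX.derivN l) (suc n))))
    (≋-trans (L-applyUpTo n φ (λ m → ZX.derivN l (ZX.qbinom n m))) (sumTo-cong n term))
    where
    open ≋-Reasoning
    φ : ℕ → ZX.Poly
    φ m = eval P (nat m)
    term : ∀ m → (w ^P m) *P (const (φ m) *P liftZ (ZX.derivN l (ZX.qbinom n m))) ≋₂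
      const ((ZX.X ZX.^P m) ZX.*P φ m) *P ((X ^P (z * m)) *P liftZ (ZX.derivN l (ZX.qbinom n m)))
    term m = begin
      (w ^P m) *P (const (φ m) *P B)
        ≈⟨ *P-congʳ (const (φ m) *P B) (w^ m) ⟩
      (const (ZX.X ZX.^P m) *P (X ^P (z * m))) *P (const (φ m) *P B)
        ≈⟨ solve 4 (λ t x p b → (t :* x) :* (p :* b) := (t :* p) :* (x :* b)) ≋-refl (const (ZX.X ZX.^P m)) (X ^P (z * m)) (const (φ m)) B ⟩
      (const (ZX.X ZX.^P m) *P const (φ m)) *P ((X ^P (z * m)) *P B)
        ≈⟨ *P-congʳ ((X ^P (z * m)) *P B) (const-*P (ZX.X ZX.^P m) (φ m)) ⟨
      const ((ZX.X ZX.^P m) ZX.*P φ m) *P ((X ^P (z * m)) *P B) ∎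
      where B = liftZ (ZX.derivN l (ZX.qbinom n m))

  -- With a = length P + 2(l + d) blocks the available budget is 2 + a. The coefficient polynomial
  -- costs `length P`, the derivatives 2l and the powers of Φ_N 2(d + 1), so the balance is exact.
  I-lhs : ∀ d l P n → (length P + 2 * (l + d)) * k * c ≤ n → I (suc d) (lhs P z l n)
  I-lhs d l P n le = I-cong (lhs-L P l n)
    (G-bound (G-rogersSzegő (length P + 2 * (l + d)) n (≡.subst (_≤ n) (ℕₚ.*-assoc (length P + 2 * (l + d)) k c) le))
      l (length P) (suc d) (λ m → eval P (nat m)) (Deg<-eval P) (ℕₚ.≤-reflexive (budget (length P) l d)))
    where
    budget : ∀ p l d → p + ((l + l) + (suc d + suc d)) ≡ 2 + (p + 2 * (l + d))
    budget = solve-∀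

theorem1p1 : (c k : ℕ) → 0 < c → 0 < k → k % 2 ≡ 1 →
    (d l z : ℕ) → (P : List ZX.Poly) →
    (n : ℕ) → (length P + 2 * (l + d)) * k * c ≤ n →
    DividesInZζ[q] c (liftZ (Φ (k * c) ZX.^P (d + 1))) (lhs P z l n)
theorem1p1 c k 0<c 0<k odd d l z P n le = q , r ,
  at₂ (≋-trans eq (≡⇒≋ (≡.cong (λ e → (liftZ (Φ (k * c) ZX.^P e) *P q) +P (const (Φ (2 * c)) *P r)) (ℕₚ.+-comm 1 d))))
  where
  open CyclotomicIdeal c k z 0<c 0<k odd
  open I (I-lhs d l P n le)
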